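{- Let $\mathcal F=\mathbb R[x_1,x_2,\ldots]$ and define polynomials $g(d,\ell)$ by $$\exp\Big(r\sum_{j\ge1}x_j z^j\Big)=1+\sum_{d\ge\ell\ge1} g(d,\ell)\,r^\ell z^d.$$ Let $d\ge \ell\ge1$. Let $S(d,\ell)$ be the set of products $g(d_1,\ell_1)g(d_2,\ell_2)\cdots g(d_k,\ell_k)$, with $k\ge1$, satisfying all of the following: - $\sum_{i=1}^k d_i=d$ and $\sum_{i=1}^k \ell_i=\ell$; - $d_i>d_{i+1}+\ell_i$ for $i<k$; - $d_k\ge\ell_k$; - $\ell_1,\ldots,\ell_k\ge1$. Then $S(d,\ell)$ is a basis of $\mathcal F(d,\ell)$.
   Context: $\mathcal F(d,\ell)$ denotes the span of all monomials $x_{i_1}\cdots x_{i_\ell}$ with $i_1+\cdots+i_\ell=d$, that is, monomials of degree $d$ (where $\deg x_k=k$) and length $\ell$. Each $g(d,\ell)$ lies in $\mathcal F(d,\ell)$.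
   Formalization: The polynomial ring and all linear combinations have rational instead of real coefficients; that the products lie in F(d,ℓ), immediate from g(d,ℓ) lying in F(d,ℓ), is not restated in the conclusion. -}

module Defs where

open import Data.Nat as ℕ using (ℕ; zero; suc; _≤_; _<_; _!)
open import Data.Nat.Properties as ℕP using (_!≢0)
open import Data.Integer using (+_)
open import Data.Rational as ℚ using (ℚ; 0ℚ; 1ℚ)
open import Data.List using (List; []; _∷_; map; concatMap; _++_; foldr; length; last; upTo)
open import Data.Nat.ListAction using (sum)
open import Data.List.Properties using (≡-dec)
open import Data.List.Relation.Unary.All using (All)
open import Data.List.Relation.Unary.Linked using (Linked)
open import Data.Maybe using (just)
open import Data.Product using (_×_; _,_; proj₁; proj₂)
open import Relation.Binary.PropositionalEquality using (_≡_; _≢_)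
open import Relation.Nullary using (yes; no)
import Data.List.Sort as Sort

-- Polynomials in F = ℚ[x₁, x₂, …] (commuting variables).
-- A word w : List ℕ stands for the monomial x_{w₁} x_{w₂} ⋯ x_{wₙ};
-- a polynomial is a finite formal sum of terms (coefficient , word).
-- Two words denote the same monomial iff they agree after sorting.

Word : Set
Word = List ℕ

Poly : Set
Poly = List (ℚ × Word)

open Sort ℕP.≤-decTotalOrder using (sort)

coeff : Poly → Word → ℚ
coeff [] m = 0ℚ
coeff ((c , w) ∷ p) m with ≡-dec ℕP._≟_ (sort w) (sort m)
... | yes _ = c ℚ.+ coeff p m
... | no  _ = coeff p m

infix 4 _≈_
_≈_ : Poly → Poly → Set
p ≈ q = ∀ (m : Word) → coeff p m ≡ coeff q m

0P : Poly
0P = []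

1P : Poly
1P = (1ℚ , []) ∷ []

infixl 6 _+P_
_+P_ : Poly → Poly → Poly
p +P q = p ++ q

infixl 7 _*P_
_*P_ : Poly → Poly → Poly
p *P q = concatMap (λ t → map (λ s → (proj₁ t ℚ.* proj₁ s , proj₂ t ++ proj₂ s)) q) p

_·P_ : ℚ → Poly → Poly
c ·P p = map (λ t → (c ℚ.* proj₁ t , proj₂ t)) p

IsMonomial : ℕ → ℕ → Word → Set
IsMonomial d ℓ w = length w ≡ ℓ × sum w ≡ d × All (1 ≤_) w

InF : ℕ → ℕ → Poly → Set
InF d ℓ p = All (λ t → IsMonomial d ℓ (proj₂ t)) p

-- g(d,ℓ) = [r^ℓ z^d] exp(r Σ_{j≥1} x_j z^j)
--        = (1/ℓ!) [z^d] (Σ_{j≥1} x_j z^j)^ℓ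
--        = (1/ℓ!) Σ_{(j₁,…,j_ℓ) composition of d, jᵢ ≥ 1} x_{j₁}⋯x_{j_ℓ}.

compositions : ℕ → ℕ → List Word
compositions zero    zero    = [] ∷ []
compositions (suc d) zero    = []
compositions d       (suc ℓ) =
  concatMap (λ j → map (suc j ∷_) (compositions (d ℕ.∸ suc j) ℓ)) (upTo d)

g : ℕ → ℕ → Poly
g d ℓ = map (λ w → ((+ 1) ℚ./ (ℓ !)) {{ℓ !≢0}} , w) (compositions d ℓ)

Gap : ℕ × ℕ → ℕ × ℕ → Set
Gap (dᵢ , ℓᵢ) (dⱼ , ℓⱼ) = dⱼ ℕ.+ ℓᵢ < dᵢ

Admissible : ℕ → ℕ → List (ℕ × ℕ) → Set
Admissible d ℓ σ =
  σ ≢ []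
  × sum (map proj₁ σ) ≡ d
  × sum (map proj₂ σ) ≡ ℓ
  × Linked Gap σ
  × (∀ p → last σ ≡ just p → proj₂ p ≤ proj₁ p)
  × All (λ p → 1 ≤ proj₂ p) σ

gProd : List (ℕ × ℕ) → Poly
gProd σ = foldr (λ p acc → g (proj₁ p) (proj₂ p) *P acc) 1P σ

linComb : List (ℚ × List (ℕ × ℕ)) → Poly
linComb cs = foldr (λ t acc → (proj₁ t ·P gProd (proj₂ t)) +P acc) 0P cs

{-# OPTIONS --safe #-}
module Submission where

-- A linear functional y on F(d,ℓ), viewed as a symmetric function of words, is shown to vanish
-- once it kills S(d,ℓ).  Let y_{N,a} be its contraction with g(N,a), a functional on
-- F(d-N,ℓ-a).  One proves y_{N,a} = 0 for N descending and, for fixed N, a ascending.  By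
-- induction on ℓ it suffices that y_{N,a} kills each product of S(d-N,ℓ-a), with leading factor
-- g(e,b) say.  If N > e + a, prepending g(N,a) gives a product of S(d,ℓ); if e > N, exchange
-- the two factors.  In the remaining case N - a ≤ e ≤ N, put P(s) = (s-e)(s-e-1)⋯(s-N+1) and
-- consider the sum T(p) over all words w of length a + b of P(w₁ + ⋯ + w_p) y(w).  As y is
-- symmetric, T is a polynomial in p of degree at most N - e ≤ a; by what was shown before it
-- vanishes at p = 0, …, a-1 and p = a + b, hence identically, and T(a) is a non-zero multiple of
-- the contraction of y with g(N,a) g(e,b).
--
-- The elements of S(d,ℓ) are matched with the partitions of d into ℓ parts (by reading off
-- Frobenius coordinates), so linear independence and spanning follow by counting dimensions.

open import Defs
import Data.Integer as ℤ
open import Data.List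
  using (List; []; _∷_; _++_; map; concatMap; upTo; applyUpTo; replicate; length; last; deduplicate)
open import Data.List.Properties
  using (++-assoc; ++-identityʳ; length-++; length-map; length-replicate; length-++-sucʳ;
         map-∘; map-id; ≡-dec; ∷-injective)
open import Data.List.Membership.Propositional using (_∈_; find; lose)
open import Data.List.Membership.Propositional.Properties
  using (∈-map⁺; ∈-map⁻; ∈-++⁺ˡ; ∈-++⁺ʳ; ∈-++⁻; ∈-∃++;
         ∈-concatMap⁺; ∈-concatMap⁻; ∈-upTo⁺; ∈-upTo⁻; ∈-deduplicate⁺; ∈-deduplicate⁻)
open import Data.List.Relation.Binary.Permutation.Propositional
  using (_↭_; ↭-refl; ↭-sym; ↭-trans; ↭-reflexive; ↭⇒↭ₛ; prep; swap)
open import Data.List.Relation.Binary.Permutation.Propositional.Properties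
  using (shift; shifts; ++⁺ˡ; ++⁺ʳ; ++-comm; ↭-length; All-resp-↭)
open import Data.List.Relation.Binary.Pointwise using (Pointwise-≡⇒≡)
open import Data.List.Relation.Unary.All as All using (All; []; _∷_)
import Data.List.Relation.Unary.All.Properties as AllP
open import Data.List.Relation.Unary.AllPairs as AllPairs using (AllPairs; []; _∷_)
import Data.List.Relation.Unary.AllPairs.Properties as AllPairsP
open import Data.List.Relation.Unary.Any using (Any; here; there; satisfied)
open import Data.List.Relation.Unary.Linked using (Linked; []; [-]; _∷_)
open import Data.List.Relation.Unary.Linked.Properties using (Linked⇒AllPairs; AllPairs⇒Linked)
open import Data.List.Relation.Unary.Sorted.TotalOrder.Properties using (↗↭↗⇒≋)
open import Data.List.Relation.Unary.Unique.Propositional using (Unique)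
open import Data.List.Relation.Unary.Unique.DecPropositional.Properties using (deduplicate-!)
import Data.List.Sort as Sort
open import Data.Maybe using (just)
import Data.Maybe.Relation.Unary.All as Maybe
open import Data.Nat as ℕ using (ℕ; zero; suc; _≤_; _<_; _≥_; z≤n; s≤s; _!)
import Data.Nat.Properties as ℕP
open import Data.Nat.ListAction using (sum)
open import Data.Nat.ListAction.Properties using (sum-++; sum-↭)
open import Data.Nat.Tactic.RingSolver using (solve-∀)
open import Data.Product using (_×_; Σ; _,_; proj₁; proj₂; ∃-syntax)
open import Data.Rational as ℚ using (ℚ; 0ℚ; 1ℚ; _+_; _*_; -_; _-_)
import Data.Rational.Properties as ℚP
import Data.Rational.Solver as ℚSolver
open import Data.Sum using (_⊎_; inj₁; inj₂)
open import Function using (_∘_; flip)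
open import Relation.Binary.Definitions using (tri<; tri≈; tri>)
import Relation.Binary.Construct.Flip.EqAndOrd as Flip
open import Relation.Binary.PropositionalEquality
  using (_≡_; _≢_; refl; sym; trans; cong; cong₂; subst; subst₂; module ≡-Reasoning)
open import Relation.Nullary using (¬_; Dec; yes; no; contradiction; _×-dec_)
open import Relation.Nullary.Decidable using (decidable-stable)
open ℚSolver.+-*-Solver using (solve; _:=_; _:+_; _:*_; :-_; _:-_; con)

private variable A B : Set

-- Finite sums of rationals

∑ : List A → (A → ℚ) → ℚ
∑ []       f = 0ℚ
∑ (x ∷ xs) f = f x + ∑ xs f

syntax ∑ xs (λ x → e) = ∑[ x ∈ xs ] e
infix 8 ∑

∑-cong-∈ : ∀ (xs : List A) {f g : A → ℚ} → (∀ {x} → x ∈ xs → f x ≡ g x) → ∑ xs f ≡ ∑ xs g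
∑-cong-∈ []       h = refl
∑-cong-∈ (x ∷ xs) h = cong₂ _+_ (h (here refl)) (∑-cong-∈ xs (h ∘ there))

∑-cong : ∀ (xs : List A) {f g : A → ℚ} → (∀ x → f x ≡ g x) → ∑ xs f ≡ ∑ xs g
∑-cong xs h = ∑-cong-∈ xs (λ {x} _ → h x)

∑-0 : ∀ (xs : List A) → ∑ xs (λ _ → 0ℚ) ≡ 0ℚ
∑-0 []       = refl
∑-0 (x ∷ xs) = trans (ℚP.+-identityˡ _) (∑-0 xs)

∑-zero : ∀ (xs : List A) {f : A → ℚ} → (∀ {x} → x ∈ xs → f x ≡ 0ℚ) → ∑ xs f ≡ 0ℚ
∑-zero xs h = trans (∑-cong-∈ xs h) (∑-0 xs)

∑-+ : ∀ (xs : List A) (f g : A → ℚ) → ∑[ x ∈ xs ] (f x + g x) ≡ ∑ xs f + ∑ xs g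
∑-+ []       f g = refl
∑-+ (x ∷ xs) f g rewrite ∑-+ xs f g =
  solve 4 (λ a b c d → (a :+ b) :+ (c :+ d) := (a :+ c) :+ (b :+ d)) refl (f x) (g x) (∑ xs f) (∑ xs g)

∑-*ˡ : ∀ (xs : List A) c (f : A → ℚ) → ∑[ x ∈ xs ] (c * f x) ≡ c * ∑ xs f
∑-*ˡ []       c f = sym (ℚP.*-zeroʳ c)
∑-*ˡ (x ∷ xs) c f rewrite ∑-*ˡ xs c f = sym (ℚP.*-distribˡ-+ c (f x) (∑ xs f))

∑-- : ∀ (xs : List A) (f g : A → ℚ) → ∑[ x ∈ xs ] (f x - g x) ≡ ∑ xs f - ∑ xs g
∑-- []       f g = refl
∑-- (x ∷ xs) f g rewrite ∑-- xs f g =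
  solve 4 (λ a b c d → (a :- b) :+ (c :- d) := (a :+ c) :- (b :+ d)) refl (f x) (g x) (∑ xs f) (∑ xs g)

∑-swap : ∀ (xs : List A) (ys : List B) (f : A → B → ℚ) →
  ∑[ x ∈ xs ] ∑[ y ∈ ys ] f x y ≡ ∑[ y ∈ ys ] ∑[ x ∈ xs ] f x y
∑-swap []       ys f = sym (∑-0 ys)
∑-swap (x ∷ xs) ys f rewrite ∑-swap xs ys f = sym (∑-+ ys (f x) _)

∑-++ : ∀ (xs ys : List A) (f : A → ℚ) → ∑ (xs ++ ys) f ≡ ∑ xs f + ∑ ys f
∑-++ []       ys f = sym (ℚP.+-identityˡ _)
∑-++ (x ∷ xs) ys f rewrite ∑-++ xs ys f = sym (ℚP.+-assoc (f x) _ _)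

∑-map : ∀ (h : A → B) xs (f : B → ℚ) → ∑ (map h xs) f ≡ ∑ xs (f ∘ h)
∑-map h []       f = refl
∑-map h (x ∷ xs) f = cong (f (h x) +_) (∑-map h xs f)

∑-concatMap : ∀ (h : A → List B) xs (f : B → ℚ) → ∑ (concatMap h xs) f ≡ ∑[ x ∈ xs ] ∑ (h x) f
∑-concatMap h []       f = refl
∑-concatMap h (x ∷ xs) f = trans (∑-++ (h x) _ f) (cong (∑ (h x) f +_) (∑-concatMap h xs f))

∑≢0⇒∃ : ∀ (xs : List A) {f : A → ℚ} → ∑ xs f ≢ 0ℚ → ∃[ x ] x ∈ xs × f x ≢ 0ℚ
∑≢0⇒∃ []       s≢0 = contradiction refl s≢0
∑≢0⇒∃ (x ∷ xs) {f} s≢0 with f x ℚP.≟ 0ℚ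
... | no  fx≢0 = x , here refl , fx≢0
... | yes fx≡0 with ∑≢0⇒∃ xs {f} (λ e → s≢0 (cong₂ _+_ fx≡0 e))
...   | y , y∈ , fy≢0 = y , there y∈ , fy≢0

∑-applyUpTo : ∀ (h : ℕ → A) n (f : A → ℚ) → ∑ (applyUpTo h n) f ≡ ∑ (upTo n) (f ∘ h)
∑-applyUpTo h zero    f = refl
∑-applyUpTo h (suc n) f = cong (f (h 0) +_)
  (trans (∑-applyUpTo (h ∘ suc) n f) (sym (∑-applyUpTo suc n (f ∘ h))))

∑-upTo-zero : ∀ n (f : ℕ → ℚ) → (∀ i → i < n → f i ≡ 0ℚ) → ∑ (upTo n) f ≡ 0ℚ
∑-upTo-zero zero    f h = refl
∑-upTo-zero (suc n) f h = cong₂ _+_ (h 0 (s≤s z≤n))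
  (trans (∑-applyUpTo suc n f) (∑-upTo-zero n (f ∘ suc) (λ i i<n → h (suc i) (s≤s i<n))))

∑-upTo-single : ∀ n k (f : ℕ → ℚ) → k < n → (∀ i → i < n → i ≢ k → f i ≡ 0ℚ) → ∑ (upTo n) f ≡ f k
∑-upTo-single (suc n) zero f _ h = trans
  (cong (f 0 +_) (trans (∑-applyUpTo suc n f)
    (∑-upTo-zero n (f ∘ suc) (λ i i<n → h (suc i) (s≤s i<n) (λ ())))))
  (ℚP.+-identityʳ (f 0))
∑-upTo-single (suc n) (suc k) f (s≤s k<n) h = trans
  (cong₂ _+_ (h 0 (s≤s z≤n) (λ ())) (trans (∑-applyUpTo suc n f)
    (∑-upTo-single n k (f ∘ suc) k<n (λ i i<n i≢k → h (suc i) (s≤s i<n) (i≢k ∘ ℕP.suc-injective)))))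
  (ℚP.+-identityˡ (f (suc k)))

*-zero-cases : ∀ p q → p * q ≡ 0ℚ → p ≢ 0ℚ → q ≡ 0ℚ
*-zero-cases p q pq≡0 p≢0 = begin
  q                  ≡⟨ ℚP.*-identityˡ q ⟨
  1ℚ * q             ≡⟨ cong (_* q) (ℚP.*-inverseˡ p) ⟨
  (ℚ.1/ p * p) * q   ≡⟨ ℚP.*-assoc (ℚ.1/ p) p q ⟩
  ℚ.1/ p * (p * q)   ≡⟨ cong (ℚ.1/ p *_) pq≡0 ⟩
  ℚ.1/ p * 0ℚ        ≡⟨ ℚP.*-zeroʳ (ℚ.1/ p) ⟩
  0ℚ                 ∎
  where
    open ≡-Reasoning
    instance
      p-nonZero : ℚ.NonZero p
      p-nonZero = ℚ.≢-nonZero p≢0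

*≢0 : ∀ {p q} → p ≢ 0ℚ → q ≢ 0ℚ → p * q ≢ 0ℚ
*≢0 p≢0 q≢0 e = q≢0 (*-zero-cases _ _ e p≢0)

*≢0ʳ : ∀ p q → p * q ≢ 0ℚ → q ≢ 0ℚ
*≢0ʳ p q pq≢0 refl = pq≢0 (ℚP.*-zeroʳ p)

δ : ℕ → ℕ → ℚ
δ m n with m ℕP.≟ n
... | yes _ = 1ℚ
... | no  _ = 0ℚ

δ-refl : ∀ n → δ n n ≡ 1ℚ
δ-refl n with n ℕP.≟ n
... | yes _  = refl
... | no n≢n = contradiction refl n≢n

δ-≢ : ∀ {m n} → m ≢ n → δ m n ≡ 0ℚ
δ-≢ {m} {n} m≢n with m ℕP.≟ n
... | yes m≡n = contradiction m≡n m≢n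
... | no  _   = refl

δ≢0⇒≡ : ∀ m n x → δ m n * x ≢ 0ℚ → m ≡ n
δ≢0⇒≡ m n x h with m ℕP.≟ n
... | yes m≡n = m≡n
... | no  _   = contradiction (ℚP.*-zeroˡ x) h

δ-guard : ∀ m n {x y} → (m ≡ n → x ≡ y) → δ m n * x ≡ δ m n * y
δ-guard m n {x} {y} h with m ℕP.≟ n
... | yes m≡n = cong (1ℚ *_) (h m≡n)
... | no  _   = trans (ℚP.*-zeroˡ x) (sym (ℚP.*-zeroˡ y))

δ-iff : ∀ {m n m' n'} → (m ≡ n → m' ≡ n') → (m' ≡ n' → m ≡ n) → δ m n ≡ δ m' n'
δ-iff {m} {n} {m'} {n'} f g with m ℕP.≟ n | m' ℕP.≟ n'
... | yes _ | yes _ = refl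
... | no  _ | no  _ = refl
... | yes p | no ¬p = contradiction (f p) ¬p
... | no ¬p | yes p = contradiction (g p) ¬p

-- Polynomial functions through finite differences

-- Degree at most j.
HasDegree : ℕ → (ℕ → ℚ) → Set
HasDegree zero    P = ∀ x s → P (x ℕ.+ s) ≡ P s
HasDegree (suc j) P = ∀ x → HasDegree j (λ s → P (x ℕ.+ s) - P s)

HasDegree-cong : ∀ j {P Q} → (∀ s → P s ≡ Q s) → HasDegree j P → HasDegree j Q
HasDegree-cong zero    h d x s = trans (sym (h _)) (trans (d x s) (h s))
HasDegree-cong (suc j) h d x = HasDegree-cong j (λ s → cong₂ _-_ (h _) (h s)) (d x)

HasDegree-+ : ∀ j {P Q} → HasDegree j P → HasDegree j Q → HasDegree j (λ s → P s + Q s)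
HasDegree-+ zero    d e x s = cong₂ _+_ (d x s) (e x s)
HasDegree-+ (suc j) {P} {Q} d e x = HasDegree-cong j
  (λ s → solve 4 (λ a b c d → (a :- b) :+ (c :- d) := (a :+ c) :- (b :+ d)) refl
           (P (x ℕ.+ s)) (P s) (Q (x ℕ.+ s)) (Q s))
  (HasDegree-+ j (d x) (e x))

HasDegree-* : ∀ j c {P} → HasDegree j P → HasDegree j (λ s → c * P s)
HasDegree-* zero    c d x s = cong (c *_) (d x s)
HasDegree-* (suc j) c {P} d x = HasDegree-cong j
  (λ s → solve 3 (λ c a b → c :* (a :- b) := c :* a :- c :* b) refl c (P (x ℕ.+ s)) (P s))
  (HasDegree-* j c (d x))

HasDegree-suc : ∀ j {P} → HasDegree j P → HasDegree (suc j) P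
HasDegree-suc zero {P} d x y s rewrite d x (y ℕ.+ s) | d x s | d y s = refl
HasDegree-suc (suc j) d x = HasDegree-suc j (d x)

HasDegree-≤ : ∀ {i j P} → i ≤ j → HasDegree i P → HasDegree j P
HasDegree-≤ {P = P} i≤j = go (ℕP.≤⇒≤′ i≤j)
  where
    go : ∀ {i j} → i ℕ.≤′ j → HasDegree i P → HasDegree j P
    go (ℕ.≤′-reflexive refl) d = d
    go (ℕ.≤′-step i≤j) d = HasDegree-suc _ (go i≤j d)

HasDegree-shift : ∀ j y {P} → HasDegree j P → HasDegree j (λ s → P (y ℕ.+ s))
HasDegree-shift zero y {P} d x s = trans (d y (x ℕ.+ s)) (trans (d x s) (sym (d y s)))
HasDegree-shift (suc j) y {P} d x = HasDegree-cong j
  (λ s → cong (λ m → P m - P (y ℕ.+ s)) (exchange s))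
  (HasDegree-shift j y (d x))
  where
    exchange : ∀ s → x ℕ.+ (y ℕ.+ s) ≡ y ℕ.+ (x ℕ.+ s)
    exchange s = trans (sym (ℕP.+-assoc x y s)) (trans (cong (ℕ._+ s) (ℕP.+-comm x y)) (ℕP.+-assoc y x s))

ι : ℕ → ℚ
ι zero    = 0ℚ
ι (suc n) = 1ℚ + ι n

ι-+ : ∀ m n → ι (m ℕ.+ n) ≡ ι m + ι n
ι-+ zero    n = sym (ℚP.+-identityˡ (ι n))
ι-+ (suc m) n = trans (cong (_+_ 1ℚ) (ι-+ m n)) (sym (ℚP.+-assoc 1ℚ (ι m) (ι n)))

ι≥0 : ∀ n → 0ℚ ℚ.≤ ι n
ι≥0 zero    = ℚP.≤-refl
ι≥0 (suc n) = ℚP.+-mono-≤ (ℚP.nonNegative⁻¹ 1ℚ) (ι≥0 n)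

ι-suc≢0 : ∀ n → ι (suc n) ≢ 0ℚ
ι-suc≢0 n e = ℚP.<⇒≢ (ℚP.+-mono-<-≤ (ℚP.positive⁻¹ 1ℚ) (ι≥0 n)) (sym e)

-- Product rule: the difference with step x of (s - c) P(s) is (s - c)(P(x + s) - P(s)) + x P(x +
-- s). Induction on j bounds the degree of the first summand.
HasDegree-linear : ∀ j c {P} → HasDegree j P → HasDegree (suc j) (λ s → (ι s - c) * P s)
HasDegree-linear j c {P} d x = HasDegree-cong j split (expand j d)
  where
    split : ∀ s → (ι s - c) * (P (x ℕ.+ s) - P s) + ι x * P (x ℕ.+ s)
                ≡ (ι (x ℕ.+ s) - c) * P (x ℕ.+ s) - (ι s - c) * P s
    split s rewrite ι-+ x s =
      solve 5 (λ i c p q k → (i :- c) :* (p :- q) :+ k :* p := (k :+ i :- c) :* p :- (i :- c) :* q)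
        refl (ι s) c (P (x ℕ.+ s)) (P s) (ι x)
    expand : ∀ j → HasDegree j P →
      HasDegree j (λ s → (ι s - c) * (P (x ℕ.+ s) - P s) + ι x * P (x ℕ.+ s))
    expand zero d y s
      rewrite d x (y ℕ.+ s) | d x s | d y s | ℚP.+-inverseʳ (P s)
            | ℚP.*-zeroʳ (ι (y ℕ.+ s) - c) | ℚP.*-zeroʳ (ι s - c) = refl
    expand (suc j) d = HasDegree-+ (suc j)
      {λ s → (ι s - c) * (P (x ℕ.+ s) - P s)} {λ s → ι x * P (x ℕ.+ s)}
      (HasDegree-linear j c (d x))
      (HasDegree-* (suc j) (ι x) {λ s → P (x ℕ.+ s)} (HasDegree-shift (suc j) x {P} d))

-- The product (s - e)(s - e - 1)⋯(s - e - k + 1), which is the P of the introduction when k = N -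
-- e.
rootsFrom : ℕ → ℕ → ℕ → ℚ
rootsFrom e zero    s = 1ℚ
rootsFrom e (suc k) s = (ι s - ι (e ℕ.+ k)) * rootsFrom e k s

rootsFrom-degree : ∀ e k → HasDegree k (rootsFrom e k)
rootsFrom-degree e zero    _ _ = refl
rootsFrom-degree e (suc k) = HasDegree-linear k (ι (e ℕ.+ k)) (rootsFrom-degree e k)

rootsFrom-root : ∀ e k s → e ≤ s → s < e ℕ.+ k → rootsFrom e k s ≡ 0ℚ
rootsFrom-root e zero s e≤s s<e rewrite ℕP.+-identityʳ e = contradiction e≤s (ℕP.<⇒≱ s<e)
rootsFrom-root e (suc k) s e≤s s<e+k with s ℕP.≟ e ℕ.+ k
... | yes refl rewrite ℚP.+-inverseʳ (ι (e ℕ.+ k)) = ℚP.*-zeroˡ (rootsFrom e k (e ℕ.+ k))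
... | no s≢ rewrite rootsFrom-root e k s e≤s
                      (ℕP.≤∧≢⇒< (ℕP.≤-pred (subst (s <_) (ℕP.+-suc e k) s<e+k)) s≢)
  = ℚP.*-zeroʳ (ι s - ι (e ℕ.+ k))

rootsFrom-nonroot : ∀ e k s → e ℕ.+ k ≤ s → rootsFrom e k s ≢ 0ℚ
rootsFrom-nonroot e zero    s _ = λ ()
rootsFrom-nonroot e (suc k) s h = *≢0 (linear-nonroot (subst (_≤ s) (ℕP.+-suc e k) h))
  (rootsFrom-nonroot e k s (ℕP.≤-trans (ℕP.+-monoʳ-≤ e (ℕP.n≤1+n k)) h))
  where
    linear-nonroot : ∀ {c} → suc c ≤ s → ι s - ι c ≢ 0ℚ
    linear-nonroot {c} c<s e = ι-suc≢0 (s ℕ.∸ suc c) (trans (sym diff) e)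
      where
        diff : ι s - ι c ≡ ι (suc (s ℕ.∸ suc c))
        diff = trans (cong (λ t → ι t - ι c)
                        (sym (trans (ℕP.+-suc c (s ℕ.∸ suc c)) (ℕP.m+[n∸m]≡n c<s))))
          (trans (cong (_- ι c) (ι-+ c (suc (s ℕ.∸ suc c))))
            (solve 2 (λ a b → a :+ b :- a := b) refl (ι c) (ι (suc (s ℕ.∸ suc c)))))

-- A function F of pairs (p , q) is regarded, on each antidiagonal p + q = L, as a function of p.
HasDegree₂ : ℕ → (ℕ → ℕ → ℚ) → Set
HasDegree₂ zero    F = ∀ p q → F (suc p) q ≡ F p (suc q)
HasDegree₂ (suc j) F = HasDegree₂ j (λ p q → F (suc p) q - F p (suc q))

HasDegree₂-cong : ∀ j {F G} → (∀ p q → F p q ≡ G p q) → HasDegree₂ j F → HasDegree₂ j G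
HasDegree₂-cong zero    h d p q = trans (sym (h _ _)) (trans (d p q) (h _ _))
HasDegree₂-cong (suc j) h d = HasDegree₂-cong j (λ p q → cong₂ _-_ (h _ _) (h _ _)) d

HasDegree₂-∑ : ∀ {A : Set} j (xs : List A) (F : A → ℕ → ℕ → ℚ) →
  (∀ x → HasDegree₂ j (F x)) → HasDegree₂ j (λ p q → ∑[ x ∈ xs ] F x p q)
HasDegree₂-∑ zero    xs F d p q = ∑-cong xs (λ x → d x p q)
HasDegree₂-∑ (suc j) xs F d = HasDegree₂-cong j (λ p q → ∑-- xs _ _)
  (HasDegree₂-∑ j xs (λ x p q → F x (suc p) q - F x p (suc q)) d)

-- binom a n is the binomial coefficient "n choose a".
binom : ℕ → ℕ → ℚ
binom zero    n       = 1ℚ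
binom (suc a) zero    = 0ℚ
binom (suc a) (suc n) = binom a n + binom (suc a) n

binom≥0 : ∀ a n → 0ℚ ℚ.≤ binom a n
binom≥0 zero    n       = ℚP.nonNegative⁻¹ 1ℚ
binom≥0 (suc a) zero    = ℚP.≤-refl
binom≥0 (suc a) (suc n) = ℚP.+-mono-≤ (binom≥0 a n) (binom≥0 (suc a) n)

binom>0 : ∀ {a n} → a ≤ n → 0ℚ ℚ.< binom a n
binom>0 z≤n = ℚP.positive⁻¹ 1ℚ
binom>0 {suc a} {suc n} (s≤s a≤n) = ℚP.+-mono-<-≤ (binom>0 a≤n) (binom≥0 (suc a) n)

-- A polynomial of degree at most a with zeros 0, ..., a - 1 is a multiple of the binomial
-- coefficient "n choose a", normalised by its value at n = a. The difference of F along the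
-- antidiagonal has the same property for a - 1, and Pascal's rule sums the differences.
interpolation : ∀ a F → HasDegree₂ a F → ∀ b → (∀ p q → p ℕ.+ q ≡ a ℕ.+ b → p < a → F p q ≡ 0ℚ) →
  ∀ n m → n ℕ.+ m ≡ a ℕ.+ b → F n m ≡ binom a n * F a b
interpolation zero F d b h zero    m refl = sym (ℚP.*-identityˡ (F 0 b))
interpolation zero F d b h (suc n) m e    =
  trans (d n m) (interpolation zero F d b h n (suc m) (trans (ℕP.+-suc n m) e))
interpolation (suc a) F d b h zero m e =
  trans (h 0 m e (s≤s z≤n)) (sym (ℚP.*-zeroˡ (F (suc a) b)))
interpolation (suc a) F d b h (suc n) m e = begin
  F (suc n) m                                       ≡⟨ split (F (suc n) m) (F n (suc m)) ⟩
  (F (suc n) m - F n (suc m)) + F n (suc m)         ≡⟨ cong₂ _+_ lower upper ⟩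
  binom a n * (F (suc a) b - F a (suc b)) + binom (suc a) n * F (suc a) b
    ≡⟨ cong (λ t → binom a n * (F (suc a) b - t) + binom (suc a) n * F (suc a) b)
         (h a (suc b) (ℕP.+-suc a b) ℕP.≤-refl) ⟩
  binom a n * (F (suc a) b - 0ℚ) + binom (suc a) n * F (suc a) b
    ≡⟨ solve 3 (λ x y f → x :* (f :- con 0ℚ) :+ y :* f := (x :+ y) :* f) refl
         (binom a n) (binom (suc a) n) (F (suc a) b) ⟩
  binom (suc a) (suc n) * F (suc a) b               ∎
  where
    open ≡-Reasoning
    split : ∀ x y → x ≡ (x - y) + y
    split = solve 2 (λ x y → x := (x :- y) :+ y) refl
    lower : F (suc n) m - F n (suc m) ≡ binom a n * (F (suc a) b - F a (suc b))
    lower = interpolation a (λ p q → F (suc p) q - F p (suc q)) d b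
      (λ p q e' p<a → cong₂ _-_ (h (suc p) q (cong suc e') (s≤s p<a))
                        (h p (suc q) (trans (ℕP.+-suc p q) (cong suc e')) (ℕP.m<n⇒m<1+n p<a)))
      n m (ℕP.suc-injective e)
    upper : F n (suc m) ≡ binom (suc a) n * F (suc a) b
    upper = interpolation (suc a) F d b h n (suc m) (trans (ℕP.+-suc n m) e)

-- The further zero at p = a + b is one more than the degree allows: by interpolation the value
-- there is a positive multiple of F(a,b).
HasDegree₂-vanishing : ∀ a F → HasDegree₂ a F → ∀ b →
  (∀ p q → p ℕ.+ q ≡ a ℕ.+ b → p < a → F p q ≡ 0ℚ) → F (a ℕ.+ b) 0 ≡ 0ℚ → F a b ≡ 0ℚ
HasDegree₂-vanishing a F d b h last≡0 = *-zero-cases (binom a (a ℕ.+ b)) (F a b)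
  (trans (sym (interpolation a F d b h (a ℕ.+ b) 0 (ℕP.+-identityʳ (a ℕ.+ b)))) last≡0)
  (λ e → ℚP.<⇒≢ (binom>0 (ℕP.m≤m+n a b)) (sym e))

-- Symmetric functionals on words and their contractions

Symmetric : (Word → ℚ) → Set
Symmetric y = ∀ {u v} → u ↭ v → y u ≡ y v

∑-upTo-extend : ∀ {m n} (f : ℕ → ℚ) → m ≤ n → (∀ i → m ≤ i → f i ≡ 0ℚ) → ∑ (upTo n) f ≡ ∑ (upTo m) f
∑-upTo-extend {zero} {n} f _ h = ∑-upTo-zero n f (λ i _ → h i z≤n)
∑-upTo-extend {suc m} {suc n} f (s≤s m≤n) h = cong (f 0 +_)
  (trans (∑-applyUpTo suc n f)
    (trans (∑-upTo-extend (f ∘ suc) m≤n (λ i m≤i → h (suc i) (s≤s m≤i)))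
      (sym (∑-applyUpTo suc m f))))

∑-δ-total : ∀ K m x → (x ≢ 0ℚ → m ≤ K) → ∑[ d ∈ upTo (suc K) ] (δ m d * x) ≡ x
∑-δ-total K m x h with x ℚP.≟ 0ℚ
... | yes refl = ∑-zero (upTo (suc K)) (λ {d} _ → ℚP.*-zeroʳ (δ m d))
... | no  x≢0  = trans
  (∑-upTo-single (suc K) m (λ d → δ m d * x) (s≤s (h x≢0))
    (λ d _ d≢m → trans (cong (_* x) (δ-≢ (d≢m ∘ sym))) (ℚP.*-zeroˡ x)))
  (trans (cong (_* x) (δ-refl m)) (ℚP.*-identityˡ x))

-- The clauses of `compositions` split on d, so this equation holds by computation only once d is a
-- constructor.
compositions-suc : ∀ d p →
  compositions d (suc p) ≡ concatMap (λ j → map (suc j ∷_) (compositions (d ℕ.∸ suc j) p)) (upTo d)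
compositions-suc zero    p = refl
compositions-suc (suc d) p = refl

-- In degree at most B no letter exceeds B.
module Slices (B : ℕ) where

  -- The sum of the letters is left free, so that sums over prefixes and suffixes can be
  -- interchanged and split letter by letter; `δ` imposes the degree where it is wanted.
  words : ℕ → List Word
  words zero    = [] ∷ []
  words (suc p) = concatMap (λ x → map (suc x ∷_) (words p)) (upTo B)

  ∑-words-suc : ∀ p (f : Word → ℚ) →
    ∑ (words (suc p)) f ≡ ∑[ x ∈ upTo B ] ∑[ u ∈ words p ] f (suc x ∷ u)
  ∑-words-suc p f = trans (∑-concatMap _ (upTo B) f)
    (∑-cong (upTo B) (λ x → ∑-map (suc x ∷_) (words p) f))

  ∈-words : ∀ p {u} → u ∈ words p → length u ≡ p × All (1 ≤_) u
  ∈-words zero    (here refl) = refl , []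
  ∈-words (suc p) u∈ with satisfied (∈-concatMap⁻ (λ x → map (suc x ∷_) (words p)) {xs = upTo B} u∈)
  ... | x , u∈x with ∈-map⁻ (suc x ∷_) u∈x
  ...   | u' , u'∈ , refl with ∈-words p u'∈
  ...     | e , pos = cong suc e , s≤s z≤n ∷ pos

  ∑-compositions : ∀ d p (f : Word → ℚ) → d ≤ B →
    ∑ (compositions d p) f ≡ ∑[ u ∈ words p ] (δ (sum u) d * f u)
  ∑-compositions zero    zero f _ = cong (_+ 0ℚ) (sym (ℚP.*-identityˡ (f [])))
  ∑-compositions (suc d) zero f _ = sym (cong (_+ 0ℚ) (ℚP.*-zeroˡ (f [])))
  ∑-compositions d (suc p) f d≤B = begin
    ∑ (compositions d (suc p)) f
      ≡⟨ cong (λ ws → ∑ ws f) (compositions-suc d p) ⟩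
    ∑ (concatMap (λ j → map (suc j ∷_) (compositions (d ℕ.∸ suc j) p)) (upTo d)) f
      ≡⟨ ∑-concatMap _ (upTo d) f ⟩
    ∑[ j ∈ upTo d ] ∑ (map (suc j ∷_) (compositions (d ℕ.∸ suc j) p)) f
      ≡⟨ ∑-cong-∈ (upTo d) (λ {j} j∈ → first-letter j (∈-upTo⁻ j∈)) ⟩
    ∑[ j ∈ upTo d ] ∑[ u ∈ words p ] (δ (suc j ℕ.+ sum u) d * f (suc j ∷ u))
      -- A first letter above d already makes the sum of the word too large, so the added terms
      -- vanish.
      ≡⟨ ∑-upTo-extend _ d≤B (λ j d≤j → ∑-zero (words p) (λ {u} _ →
           trans (cong (_* f (suc j ∷ u)) (δ-≢ (λ e → ℕP.<⇒≱ (s≤s d≤j)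
             (subst (suc j ≤_) e (ℕP.m≤m+n (suc j) (sum u)))))) (ℚP.*-zeroˡ (f (suc j ∷ u))))) ⟨
    ∑[ j ∈ upTo B ] ∑[ u ∈ words p ] (δ (suc j ℕ.+ sum u) d * f (suc j ∷ u))
      ≡⟨ ∑-words-suc p _ ⟨
    ∑[ u ∈ words (suc p) ] (δ (sum u) d * f u) ∎
    where
      open ≡-Reasoning
      first-letter : ∀ j → j < d → ∑ (map (suc j ∷_) (compositions (d ℕ.∸ suc j) p)) f
        ≡ ∑[ u ∈ words p ] (δ (suc j ℕ.+ sum u) d * f (suc j ∷ u))
      first-letter j j<d = trans (∑-map (suc j ∷_) (compositions (d ℕ.∸ suc j) p) f)
        (trans (∑-compositions (d ℕ.∸ suc j) p (f ∘ (suc j ∷_)) (ℕP.≤-trans (ℕP.m∸n≤m d (suc j)) d≤B))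
          (∑-cong (words p) (λ u → cong (_* f (suc j ∷ u)) (δ-iff
            (λ e → trans (cong (suc j ℕ.+_) e) (ℕP.m+[n∸m]≡n j<d))
            (λ e → trans (sym (ℕP.m+n∸m≡n (suc j) (sum u))) (cong (ℕ._∸ suc j) e))))))

  -- The contraction y_{N,p} of the introduction multiplied by p!. The arguments come as length,
  -- then degree, opposite to those of `g`.
  slice : ℕ → ℕ → (Word → ℚ) → Word → ℚ
  slice p N y v = ∑[ u ∈ words p ] (δ (sum u) N * y (u ++ v))

  slice-zero : ∀ p N {y : Word → ℚ} → (∀ w → y w ≡ 0ℚ) → ∀ v → slice p N y v ≡ 0ℚ
  slice-zero p N h v = ∑-zero (words p)
    (λ {u} _ → trans (cong (δ (sum u) N *_) (h (u ++ v))) (ℚP.*-zeroʳ (δ (sum u) N)))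

  slice-symmetric : ∀ p N {y} → Symmetric y → Symmetric (slice p N y)
  slice-symmetric p N sy u↭v = ∑-cong (words p) (λ w → cong (δ (sum w) N *_) (sy (++⁺ˡ w u↭v)))

  slice≢0⇒∃ : ∀ p N y v → slice p N y v ≢ 0ℚ →
    ∃[ u ] length u ≡ p × All (1 ≤_) u × sum u ≡ N × y (u ++ v) ≢ 0ℚ
  slice≢0⇒∃ p N y v h with ∑≢0⇒∃ (words p) h
  ... | u , u∈ , h' with ∈-words p u∈
  ...   | len , pos = u , len , pos , δ≢0⇒≡ (sum u) N (y (u ++ v)) h' , *≢0ʳ (δ (sum u) N) (y (u ++ v)) h'

  -- The symmetry of y lets the two summed prefixes trade places; this is dual to the commutation of
  -- two factors `g`.
  slice-comm : ∀ p d q e {y} → Symmetric y → ∀ v → slice p d (slice q e y) v ≡ slice q e (slice p d y) v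
  slice-comm p d q e {y} sy v = begin
    ∑[ u ∈ words p ] (δ (sum u) d * ∑[ w ∈ words q ] (δ (sum w) e * y (w ++ u ++ v)))
      ≡⟨ ∑-cong (words p) (λ u → ∑-*ˡ (words q) (δ (sum u) d) _) ⟨
    ∑[ u ∈ words p ] ∑[ w ∈ words q ] (δ (sum u) d * (δ (sum w) e * y (w ++ u ++ v)))
      ≡⟨ ∑-swap (words p) (words q) _ ⟩
    ∑[ w ∈ words q ] ∑[ u ∈ words p ] (δ (sum u) d * (δ (sum w) e * y (w ++ u ++ v)))
      ≡⟨ ∑-cong (words q) (λ w → ∑-cong (words p) (λ u → trans
           (cong (λ t → δ (sum u) d * (δ (sum w) e * t)) (sy (shifts w u)))
           (solve 3 (λ a b c → a :* (b :* c) := b :* (a :* c)) refl (δ (sum u) d) (δ (sum w) e) (y (u ++ w ++ v))))) ⟩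
    ∑[ w ∈ words q ] ∑[ u ∈ words p ] (δ (sum w) e * (δ (sum u) d * y (u ++ w ++ v)))
      ≡⟨ ∑-cong (words q) (λ w → ∑-*ˡ (words p) (δ (sum w) e) _) ⟩
    ∑[ w ∈ words q ] (δ (sum w) e * ∑[ u ∈ words p ] (δ (sum u) d * y (u ++ w ++ v))) ∎
    where open ≡-Reasoning

  -- The sum T(p) of the introduction, with q = a + b - p.
  weighted : ℕ → ℕ → (ℕ → ℚ) → (Word → ℚ) → ℚ
  weighted p q P y = ∑[ u ∈ words p ] (P (sum u) * ∑[ v ∈ words q ] y (u ++ v))

  weighted-left : ∀ p q P y → weighted (suc p) q P y
    ≡ ∑[ x ∈ upTo B ] weighted p q (λ s → P (suc x ℕ.+ s)) (y ∘ (suc x ∷_))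
  weighted-left p q P y = ∑-words-suc p _

  -- By symmetry the first letter of the second block moves to the front of the word. Unlike the
  -- letter split off in `weighted-left`, it does not shift the argument of P.
  weighted-right : ∀ p q P {y} → Symmetric y →
    weighted p (suc q) P y ≡ ∑[ x ∈ upTo B ] weighted p q P (y ∘ (suc x ∷_))
  weighted-right p q P {y} sy = trans
    (∑-cong (words p) (λ u → trans
      (cong (P (sum u) *_) (trans (∑-words-suc q _)
        (∑-cong (upTo B) (λ x → ∑-cong (words q) (λ v → sy (shift (suc x) u v))))))
      (sym (∑-*ˡ (upTo B) (P (sum u)) _))))
    (∑-swap (words p) (upTo B) _)

  weighted-cong : ∀ p q P Q y → (∀ s → P s ≡ Q s) → weighted p q P y ≡ weighted p q Q y
  weighted-cong p q P Q y h = ∑-cong (words p) (λ u → cong (_* ∑[ v ∈ words q ] y (u ++ v)) (h (sum u)))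

  weighted-- : ∀ p q P Q y →
    weighted p q (λ s → P s - Q s) y ≡ weighted p q P y - weighted p q Q y
  weighted-- p q P Q y = trans
    (∑-cong (words p) (λ u → solve 3 (λ a b c → (a :- b) :* c := a :* c :- b :* c) refl
      (P (sum u)) (Q (sum u)) (∑[ v ∈ words q ] y (u ++ v))))
    (∑-- (words p) _ _)

  -- Raising p by one at fixed p + q moves one letter x into the first block. The change is a sum
  -- over x of expressions of the same kind with P(s) replaced by P(x + s) - P(s), whose degree
  -- bound is one lower.
  weighted-degree : ∀ j P y → Symmetric y → HasDegree j P → HasDegree₂ j (λ p q → weighted p q P y)
  weighted-degree zero P y sy d p q = trans (weighted-left p q P y)
    (trans (∑-cong (upTo B) (λ x → weighted-cong p q (λ s → P (suc x ℕ.+ s)) P (y ∘ (suc x ∷_)) (d (suc x))))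
      (sym (weighted-right p q P sy)))
  weighted-degree (suc j) P y sy d = HasDegree₂-cong j difference
    (HasDegree₂-∑ j (upTo B) _ (λ x →
      weighted-degree j (λ s → P (suc x ℕ.+ s) - P s) (y ∘ (suc x ∷_)) (sy ∘ prep (suc x)) (d (suc x))))
    where
      difference : ∀ p q →
        ∑[ x ∈ upTo B ] weighted p q (λ s → P (suc x ℕ.+ s) - P s) (y ∘ (suc x ∷_))
          ≡ weighted (suc p) q P y - weighted p (suc q) P y
      difference p q = trans (∑-cong (upTo B) (λ x → weighted-- p q (λ s → P (suc x ℕ.+ s)) P (y ∘ (suc x ∷_))))
        (trans (∑-- (upTo B) _ _)
          (sym (cong₂ _-_ (weighted-left p q P y) (weighted-right p q P sy))))

  ∑-by-sum : ∀ p K (h : ℕ → ℚ) (F : Word → ℚ) → (∀ u → F u ≢ 0ℚ → sum u ≤ K) →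
    ∑[ u ∈ words p ] (h (sum u) * F u)
      ≡ ∑[ d ∈ upTo (suc K) ] (h d * ∑[ u ∈ words p ] (δ (sum u) d * F u))
  ∑-by-sum p K h F bound = begin
    ∑[ u ∈ words p ] (h (sum u) * F u)
      ≡⟨ ∑-cong (words p) (λ u → ∑-δ-total K (sum u) (h (sum u) * F u) (λ e → bound u (*≢0ʳ (h (sum u)) (F u) e))) ⟨
    ∑[ u ∈ words p ] ∑[ d ∈ upTo (suc K) ] (δ (sum u) d * (h (sum u) * F u))
      ≡⟨ ∑-cong (words p) (λ u → ∑-cong (upTo (suc K)) (λ d → trans
           (δ-guard (sum u) d (λ e → cong (λ t → h t * F u) e))
           (solve 3 (λ a b c → a :* (b :* c) := b :* (a :* c)) refl (δ (sum u) d) (h d) (F u)))) ⟩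
    ∑[ u ∈ words p ] ∑[ d ∈ upTo (suc K) ] (h d * (δ (sum u) d * F u))
      ≡⟨ ∑-swap (words p) (upTo (suc K)) _ ⟩
    ∑[ d ∈ upTo (suc K) ] ∑[ u ∈ words p ] (h d * (δ (sum u) d * F u))
      ≡⟨ ∑-cong (upTo (suc K)) (λ d → ∑-*ˡ (words p) (h d) _) ⟩
    ∑[ d ∈ upTo (suc K) ] (h d * ∑[ u ∈ words p ] (δ (sum u) d * F u)) ∎
    where open ≡-Reasoning

  -- The case e ≤ N ≤ e + a of the introduction, for a functional concentrated in degree N + e.
  -- `above` and `below` record the slices already known to vanish: those of larger degree, and
  -- those of degree N and smaller length.
  module Crossing {y : Word → ℚ} (sy : Symmetric y) (N a e b : ℕ)
    (supp : ∀ w → y w ≢ 0ℚ → sum w ≡ N ℕ.+ e)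
    (1≤e : 1 ≤ e) (e≤N : e ≤ N) (N≤e+a : N ≤ e ℕ.+ a)
    (above : ∀ M p r → N < M → slice p M y r ≡ 0ℚ)
    (below : ∀ p r → p < a → slice p N y r ≡ 0ℚ) where

    private
      k = N ℕ.∸ e
      P = rootsFrom e k

      e+k≡N : e ℕ.+ k ≡ N
      e+k≡N = ℕP.m+[n∸m]≡n e≤N

      tails : ℕ → Word → ℚ
      tails q u = ∑[ v ∈ words q ] y (u ++ v)

      -- The coefficient of P(d) when `weighted p q P y` is expanded by the sum d of the first p
      -- letters.
      part : ℕ → ℕ → ℕ → ℚ
      part p q d = ∑[ u ∈ words p ] (δ (sum u) d * tails q u)

      sum-split : ∀ u v → y (u ++ v) ≢ 0ℚ → sum u ℕ.+ sum v ≡ N ℕ.+ e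
      sum-split u v h = trans (sym (sum-++ u v)) (supp (u ++ v) h)

      -- Once the first letters have sum d, the others have sum N + e - d wherever y is non-zero.
      -- The free sum over suffixes is therefore a slice, after symmetry has moved the suffix to the
      -- front.
      tails-slice : ∀ q u {d} → sum u ≡ d → d ≤ N ℕ.+ e → tails q u ≡ slice q (N ℕ.+ e ℕ.∸ d) y u
      tails-slice q u {d} refl d≤ = ∑-cong (words q) term
        where
          term : ∀ v → y (u ++ v) ≡ δ (sum v) (N ℕ.+ e ℕ.∸ sum u) * y (v ++ u)
          term v rewrite sy (++-comm v u) with y (u ++ v) ℚP.≟ 0ℚ
          ... | yes z rewrite z = sym (ℚP.*-zeroʳ (δ (sum v) (N ℕ.+ e ℕ.∸ sum u)))
          ... | no nz rewrite sym (sum-split u v nz) | ℕP.m+n∸m≡n (sum u) (sum v) | δ-refl (sum v)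
              = sym (ℚP.*-identityˡ (y (u ++ v)))

      tails-bound : ∀ q u → tails q u ≢ 0ℚ → sum u ≤ N ℕ.+ e
      tails-bound q u h with ∑≢0⇒∃ (words q) h
      ... | v , _ , h' = subst (sum u ≤_) (sum-split u v h') (ℕP.m≤m+n (sum u) (sum v))

      part-slices : ∀ p q d → part p q d ≡ ∑[ v ∈ words q ] slice p d y v
      part-slices p q d = trans
        (∑-cong (words p) (λ u → sym (∑-*ˡ (words q) (δ (sum u) d) _)))
        (∑-swap (words p) (words q) _)

      part-slice-zero : ∀ p q d → (∀ r → slice p d y r ≡ 0ℚ) → part p q d ≡ 0ℚ
      part-slice-zero p q d h = trans (part-slices p q d) (∑-zero (words q) (λ {v} _ → h v))

      part-tails-zero : ∀ p q d → d ≤ N ℕ.+ e → (∀ r → slice q (N ℕ.+ e ℕ.∸ d) y r ≡ 0ℚ) → part p q d ≡ 0ℚ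
      part-tails-zero p q d d≤ h = ∑-zero (words p) (λ {u} _ → trans
        (δ-guard (sum u) d (λ e → trans (tails-slice q u e d≤) (h u)))
        (ℚP.*-zeroʳ (δ (sum u) d)))

      -- If d > N, the slice over the prefix vanishes by `above`. If e ≤ d < N, then d is a root of
      -- P. If d < e, the suffix has sum N + e - d > N, so the slice over the suffix vanishes by
      -- `above`.
      term-off-N : ∀ p q d → d ≢ N → P d * part p q d ≡ 0ℚ
      term-off-N p q d d≢N with ℕP.<-cmp d N | e ℕP.≤? d
      ... | tri> _ _ N<d | _ = trans
        (cong (P d *_) (part-slice-zero p q d (λ r → above d p r N<d))) (ℚP.*-zeroʳ (P d))
      ... | tri≈ _ d≡N _ | _ = contradiction d≡N d≢N
      ... | tri< d<N _ _ | yes e≤d = trans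
        (cong (_* part p q d) (rootsFrom-root e k d e≤d (subst (d <_) (sym e+k≡N) d<N)))
        (ℚP.*-zeroˡ (part p q d))
      ... | tri< d<N _ _ | no e≰d = trans
        (cong (P d *_) (part-tails-zero p q d (ℕP.≤-trans (ℕP.<⇒≤ d<N) (ℕP.m≤m+n N e))
          (λ r → above (N ℕ.+ e ℕ.∸ d) q r
            (subst (N <_) (sym (ℕP.+-∸-assoc N d≤e)) (ℕP.m<m+n N (ℕP.m<n⇒0<n∸m (ℕP.≰⇒> e≰d)))))))
        (ℚP.*-zeroʳ (P d))
        where d≤e = ℕP.<⇒≤ (ℕP.≰⇒> e≰d)

      weighted-part : ∀ p q → weighted p q P y ≡ P N * part p q N
      weighted-part p q = trans (∑-by-sum p (N ℕ.+ e) P (tails q) (tails-bound q))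
        (∑-upTo-single (suc (N ℕ.+ e)) N _ (s≤s (ℕP.m≤m+n N e)) (λ d _ → term-off-N p q d))

      weighted-zero : ∀ p q → part p q N ≡ 0ℚ → weighted p q P y ≡ 0ℚ
      weighted-zero p q h = trans (weighted-part p q) (trans (cong (P N *_) h) (ℚP.*-zeroʳ (P N)))

      e-complement : N ℕ.+ e ℕ.∸ N ≡ e
      e-complement = ℕP.m+n∸m≡n N e

      slice-0-e : ∀ r → slice 0 (N ℕ.+ e ℕ.∸ N) y r ≡ 0ℚ
      slice-0-e r = trans (ℚP.+-identityʳ _) (trans
        (cong (_* y r) (δ-≢ (λ 0≡ → ℕP.<⇒≢ 1≤e (trans 0≡ e-complement)))) (ℚP.*-zeroˡ (y r)))

      -- The degree N - e of P is at most a. The zeros at p < a come from `below`; the zero at p = a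
      -- + b holds because an empty suffix cannot have sum e ≥ 1.
      weighted-a-b : weighted a b P y ≡ 0ℚ
      weighted-a-b = HasDegree₂-vanishing a (λ p q → weighted p q P y)
        (weighted-degree a P y sy (HasDegree-≤ k≤a (rootsFrom-degree e k))) b
        (λ p q _ p<a → weighted-zero p q (part-slice-zero p q N (λ r → below p r p<a)))
        (weighted-zero (a ℕ.+ b) 0 (part-tails-zero (a ℕ.+ b) 0 N (ℕP.m≤m+n N e) slice-0-e))
        where
          k≤a : k ≤ a
          k≤a = subst (k ≤_) (ℕP.m+n∸m≡n e a) (ℕP.∸-monoˡ-≤ e N≤e+a)

    crossing : slice a N (slice b e y) [] ≡ 0ℚ
    crossing = trans (∑-cong (words a) (λ u → δ-guard (sum u) N (λ su≡N → begin
        slice b e y (u ++ [])            ≡⟨ cong (slice b e y) (++-identityʳ u) ⟩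
        slice b e y u                    ≡⟨ cong (λ t → slice b t y u) e-complement ⟨
        slice b (N ℕ.+ e ℕ.∸ N) y u      ≡⟨ tails-slice b u su≡N (ℕP.m≤m+n N e) ⟨
        tails b u                        ∎)))
      -- N = e + k lies beyond all roots of P, so P(N) can be cancelled from T(a).
      (*-zero-cases (P N) (part a b N) (trans (sym (weighted-part a b)) weighted-a-b)
        (rootsFrom-nonroot e k N (ℕP.≤-reflexive e+k≡N)))
      where open ≡-Reasoning

-- Functionals annihilating the admissible products

eval : {A : Set} → (A → ℚ) → List (ℚ × A) → ℚ
eval y p = ∑[ t ∈ p ] (proj₁ t * y (proj₂ t))

1/_! : ℕ → ℚ
1/ p ! = (ℤ.+ 1 ℚ./ (p !)) {{p ℕP.!≢0}}

1/!≢0 : ∀ p → 1/ p ! ≢ 0ℚ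
1/!≢0 p e = ℚP.<⇒≢ (ℚP.positive⁻¹ (1/ p !) {{ℚP.normalize-pos 1 (p !) {{p ℕP.!≢0}}}}) (sym e)

length≤sum : ∀ {w : Word} → All (1 ≤_) w → length w ≤ sum w
length≤sum []        = z≤n
length≤sum (1≤x ∷ h) = ℕP.+-mono-≤ 1≤x (length≤sum h)

module Annihilators (B : ℕ) where
  open Slices B

  -- Up to the factor 1/p! in `g`, multiplication by g(d,p) is adjoint to `slice p d`.
  eval-g* : ∀ d p q y → d ≤ B → eval y (g d p *P q) ≡ 1/ p ! * eval (slice p d y) q
  eval-g* d p q y d≤B = begin
    eval y (g d p *P q)
      ≡⟨ ∑-concatMap _ (g d p) _ ⟩
    ∑[ t ∈ g d p ] eval y (map (λ s → (proj₁ t * proj₁ s , proj₂ t ++ proj₂ s)) q)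
      ≡⟨ ∑-map _ (compositions d p) _ ⟩
    ∑[ u ∈ compositions d p ] eval y (map (λ s → (1/ p ! * proj₁ s , u ++ proj₂ s)) q)
      ≡⟨ ∑-cong (compositions d p) (λ u → ∑-map _ q _) ⟩
    ∑[ u ∈ compositions d p ] ∑[ s ∈ q ] (1/ p ! * proj₁ s * y (u ++ proj₂ s))
      ≡⟨ ∑-compositions d p _ d≤B ⟩
    ∑[ u ∈ words p ] (δ (sum u) d * ∑[ s ∈ q ] (1/ p ! * proj₁ s * y (u ++ proj₂ s)))
      ≡⟨ ∑-cong (words p) (λ u → trans (sym (∑-*ˡ q (δ (sum u) d) _))
           (∑-cong q (λ s → solve 4 (λ a b c d → a :* (b :* c :* d) := b :* (c :* (a :* d))) refl
              (δ (sum u) d) (1/ p !) (proj₁ s) (y (u ++ proj₂ s))))) ⟩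
    ∑[ u ∈ words p ] ∑[ s ∈ q ] (1/ p ! * (proj₁ s * (δ (sum u) d * y (u ++ proj₂ s))))
      ≡⟨ ∑-swap (words p) q _ ⟩
    ∑[ s ∈ q ] ∑[ u ∈ words p ] (1/ p ! * (proj₁ s * (δ (sum u) d * y (u ++ proj₂ s))))
      ≡⟨ ∑-cong q (λ s → trans (∑-*ˡ (words p) (1/ p !) _)
           (cong (1/ p ! *_) (∑-*ˡ (words p) (proj₁ s) _))) ⟩
    ∑[ s ∈ q ] (1/ p ! * (proj₁ s * slice p d y (proj₂ s)))
      ≡⟨ ∑-*ˡ q (1/ p !) _ ⟩
    1/ p ! * eval (slice p d y) q ∎
    where open ≡-Reasoning

  eval-zero : ∀ (q : Poly) {y} → (∀ w → y w ≡ 0ℚ) → eval y q ≡ 0ℚ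
  eval-zero q h = ∑-zero q (λ {t} _ → trans (cong (proj₁ t *_) (h (proj₂ t))) (ℚP.*-zeroʳ (proj₁ t)))

  -- Contraction with the single variable g(x,1) only fixes one letter, so y can be recovered from
  -- its slices of length one.
  slice-one : ∀ x y v → 1 ≤ x → x ≤ B → slice 1 x y v ≡ y (x ∷ v)
  slice-one (suc x) y v _ x<B = begin
    slice 1 (suc x) y v
      ≡⟨ ∑-words-suc 0 _ ⟩
    ∑[ i ∈ upTo B ] (δ (suc i ℕ.+ 0) (suc x) * y (suc i ∷ v) + 0ℚ)
      ≡⟨ ∑-upTo-single B x _ x<B (λ i _ i≢x → trans (ℚP.+-identityʳ _) (trans
           (cong (_* y (suc i ∷ v)) (δ-≢ (i≢x ∘ ℕP.suc-injective ∘ trans (sym (ℕP.+-identityʳ (suc i))))))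
           (ℚP.*-zeroˡ (y (suc i ∷ v))))) ⟩
    δ (suc x ℕ.+ 0) (suc x) * y (suc x ∷ v) + 0ℚ
      ≡⟨ ℚP.+-identityʳ _ ⟩
    δ (suc x ℕ.+ 0) (suc x) * y (suc x ∷ v)
      ≡⟨ cong (_* y (suc x ∷ v)) (trans (cong (λ n → δ n (suc x)) (ℕP.+-identityʳ (suc x))) (δ-refl (suc x))) ⟩
    1ℚ * y (suc x ∷ v)
      ≡⟨ ℚP.*-identityˡ _ ⟩
    y (suc x ∷ v) ∎
    where open ≡-Reasoning

  Supported : ℕ → ℕ → (Word → ℚ) → Set
  Supported D ℓ y = ∀ w → y w ≢ 0ℚ → IsMonomial D ℓ w

  -- A non-zero slice has a witness prefix of length a and sum N on which y is non-zero; its letters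
  -- are positive, whence a ≤ N.
  slice-support : ∀ {D ℓ y} a N → Supported D ℓ y → ∀ v → slice a N y v ≢ 0ℚ →
    a ℕ.+ length v ≡ ℓ × N ℕ.+ sum v ≡ D × All (1 ≤_) v × a ≤ N
  slice-support {y = y} a N supp v h with slice≢0⇒∃ a N y v h
  ... | u , refl , pos-u , refl , h' with supp (u ++ v) h'
  ...   | len , sm , all = trans (sym (length-++ u)) len , trans (sym (sum-++ u v)) sm
                         , AllP.++⁻ʳ u all , length≤sum pos-u

  slice-supported : ∀ {D ℓ y} a N → Supported D ℓ y → Supported (D ℕ.∸ N) (ℓ ℕ.∸ a) (slice a N y)
  slice-supported a N supp v h with slice-support a N supp v h
  ... | refl , refl , all , _ = sym (ℕP.m+n∸m≡n a (length v)) , sym (ℕP.m+n∸m≡n N (sum v)) , all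

  module _ {D ℓ y} (sy : Symmetric y) (supp : Supported D ℓ y) (N a : ℕ)
    (above : ∀ M p r → N < M → slice p M y r ≡ 0ℚ)
    (below : ∀ p r → p < a → slice p N y r ≡ 0ℚ) where

    -- This treats a leading factor g(e,b) before which g(N,a) cannot be placed without breaking the
    -- gap condition. If e > N, exchanging the two slices reduces to `above`; otherwise `Crossing`
    -- applies.
    slices-cross : ∀ e b → 1 ≤ b → N ≤ e ℕ.+ a → ∀ v → slice b e (slice a N y) v ≡ 0ℚ
    slices-cross e b 1≤b N≤e+a v with slice b e (slice a N y) v ℚP.≟ 0ℚ | e ℕP.≤? N
    ... | yes z | _ = z
    ... | no  _ | no e≰N = trans (slice-comm b e a N sy v)
      (slice-zero a N (λ r → above e b r (ℕP.≰⇒> e≰N)) v)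
    ... | no nz | yes e≤N = trans (slice-comm b e a N sy v) (trans append crossing)
      where
        -- Freezing the remaining letters v leaves a functional concentrated in degree N + e, as
        -- `Crossing` requires.
        y' : Word → ℚ
        y' w = y (w ++ v)

        slice-y' : ∀ p M r → slice p M y' r ≡ slice p M y (r ++ v)
        slice-y' p M r = ∑-cong (words p) (λ u → cong (λ w → δ (sum u) M * y w) (++-assoc u r v))

        append : slice a N (slice b e y) v ≡ slice a N (slice b e y') []
        append = ∑-cong (words a) (λ u → cong (δ (sum u) N *_)
          (sym (trans (slice-y' b e (u ++ [])) (cong (λ t → slice b e y (t ++ v)) (++-identityʳ u)))))

        support-v = slice-support b e (slice-supported a N supp) v nz

        N≤D : N ≤ D
        N≤D with ∑≢0⇒∃ (words b) nz
        ... | u , _ , h with slice-support a N supp (u ++ v) (*≢0ʳ (δ (sum u) e) _ h)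
        ...   | _ , refl , _ = ℕP.m≤m+n N (sum (u ++ v))

        total : N ℕ.+ e ℕ.+ sum v ≡ D
        total = trans (ℕP.+-assoc N e (sum v))
          (trans (cong (N ℕ.+_) (proj₁ (proj₂ support-v))) (ℕP.m+[n∸m]≡n N≤D))

        supp' : ∀ w → y' w ≢ 0ℚ → sum w ≡ N ℕ.+ e
        supp' w h = ℕP.+-cancelʳ-≡ (sum v) (sum w) (N ℕ.+ e)
          (trans (sym (sum-++ w v)) (trans (proj₁ (proj₂ (supp (w ++ v) h))) (sym total)))

        open Crossing {y'} (sy ∘ ++⁺ʳ v) N a e b supp'
          (ℕP.≤-trans 1≤b (proj₂ (proj₂ (proj₂ support-v)))) e≤N N≤e+a
          (λ M p r N<M → trans (slice-y' p M r) (above M p (r ++ v) N<M))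
          (λ p r p<a → trans (slice-y' p N r) (below p (r ++ v) p<a))

  admissible-singleton : ∀ {d ℓ} → 1 ≤ ℓ → ℓ ≤ d → Admissible d ℓ ((d , ℓ) ∷ [])
  admissible-singleton {d} {ℓ} 1≤ℓ ℓ≤d =
    (λ ()) , ℕP.+-identityʳ d , ℕP.+-identityʳ ℓ , [-] , (λ { _ refl → ℓ≤d }) , 1≤ℓ ∷ []

  admissible-∷ : ∀ {d ℓ d₁ ℓ₁ d₂ ℓ₂ σ} → 1 ≤ ℓ₁ → d₂ ℕ.+ ℓ₁ < d₁ → Admissible d ℓ ((d₂ , ℓ₂) ∷ σ) →
    Admissible (d₁ ℕ.+ d) (ℓ₁ ℕ.+ ℓ) ((d₁ , ℓ₁) ∷ (d₂ , ℓ₂) ∷ σ)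
  admissible-∷ 1≤ℓ₁ gap (_ , refl , refl , linked , lst , all) =
    (λ ()) , refl , refl , gap ∷ linked , lst , 1≤ℓ₁ ∷ all

  -- Induction on the length ℓ, bounded by n. The alphabet bound B stays fixed while D falls from a
  -- functional to its slices.
  annihilator-trivial : ∀ n {ℓ D y} → ℓ ≤ n → 1 ≤ ℓ → D ≤ B → Symmetric y → Supported D ℓ y →
    (∀ σ → Admissible D ℓ σ → eval y (gProd σ) ≡ 0ℚ) → ∀ w → y w ≡ 0ℚ
  annihilator-trivial zero z≤n () _ _ _ _ _
  annihilator-trivial (suc n) {ℓ} {D} {y} ℓ≤1+n 1≤ℓ D≤B sy supp kills w
    with y w ℚP.≟ 0ℚ
  ... | yes z = z
  ... | no nz = from-slices w (supp w nz)
    where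
      bottom-up : ∀ N a → 1 ≤ N →
        (∀ M p r → N < M → slice p M y r ≡ 0ℚ) → (∀ p r → p < a → slice p N y r ≡ 0ℚ) →
        ∀ v → slice a N y v ≡ 0ℚ
      -- The only word of length 0 has sum 0, whereas N ≥ 1.
      bottom-up N zero 1≤N above below v = trans (ℚP.+-identityʳ _)
        (trans (cong (_* y v) (δ-≢ (ℕP.<⇒≢ 1≤N))) (ℚP.*-zeroˡ (y v)))
      bottom-up N (suc a) 1≤N above below v with slice (suc a) N y v ℚP.≟ 0ℚ
      ... | yes z = z
      ... | no nz with slice-support (suc a) N supp v nz
      -- No letters remain, so N = D and suc a = ℓ; the single factor g(N,suc a) is admissible
      -- because suc a ≤ N.
      bottom-up N (suc a) 1≤N above below [] | no nz | refl , refl , _ , a≤N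
        with ℕP.+-identityʳ a | ℕP.+-identityʳ N
      ... | ea | eN = *-zero-cases 1ℚ _ (trans (sym (ℚP.+-identityʳ _))
          (*-zero-cases (1/ suc a !) _ (trans (sym (eval-g* N (suc a) 1P y (subst (_≤ B) eN D≤B))) kill) (1/!≢0 (suc a))))
          (λ ())
        where
          kill : eval y (gProd ((N , suc a) ∷ [])) ≡ 0ℚ
          kill = kills _ (subst₂ (λ d l → Admissible d l ((N , suc a) ∷ [])) (sym eN) (cong suc (sym ea))
            (admissible-singleton (s≤s z≤n) a≤N))
      -- Letters remain, so the slice has length between 1 and n, and the induction hypothesis
      -- applies once the slice kills every admissible product τ.
      bottom-up N (suc a) 1≤N above below v@(_ ∷ v') | no nz | refl , refl , _ , a≤N =
        annihilator-trivial n
          (subst (_≤ n) (sym (ℕP.m+n∸m≡n a (length v)))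
            (ℕP.≤-trans (ℕP.m≤n+m (length v) a) (ℕP.≤-pred ℓ≤1+n)))
          (subst (1 ≤_) (sym (ℕP.m+n∸m≡n a (length v))) (s≤s z≤n))
          (ℕP.≤-trans (ℕP.m∸n≤m D N) D≤B)
          (slice-symmetric (suc a) N sy) (slice-supported (suc a) N supp) kill v
        where
          N≤D : N ≤ N ℕ.+ sum v
          N≤D = ℕP.m≤m+n N (sum v)

          kill : ∀ τ → Admissible (D ℕ.∸ N) (ℓ ℕ.∸ suc a) τ → eval (slice (suc a) N y) (gProd τ) ≡ 0ℚ
          kill [] (τ≢[] , _) = contradiction refl τ≢[]
          kill τ@((e , b) ∷ τ') adm@(_ , sum-d , _ , _ , _ , 1≤b ∷ _) with e ℕ.+ suc a ℕP.<? N
          ... | yes gap = *-zero-cases (1/ suc a !) _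
            (trans (sym (eval-g* N (suc a) (gProd τ) y (ℕP.≤-trans N≤D D≤B)))
              (kills _ (subst₂ (λ d l → Admissible d l ((N , suc a) ∷ τ))
                (ℕP.m+[n∸m]≡n N≤D) (ℕP.m+[n∸m]≡n (ℕP.m≤m+n (suc a) (length v)))
                (admissible-∷ (s≤s z≤n) gap adm))))
            (1/!≢0 (suc a))
          ... | no ¬gap = trans (eval-g* e b (gProd τ') (slice (suc a) N y)
              (ℕP.≤-trans (subst (e ≤_) sum-d (ℕP.m≤m+n e _)) (ℕP.≤-trans (ℕP.m∸n≤m D N) D≤B)))
            (trans (cong (1/ b ! *_) (eval-zero (gProd τ')
              (slices-cross sy supp N (suc a) above below e b 1≤b (ℕP.≮⇒≥ ¬gap))))
              (ℚP.*-zeroʳ (1/ b !)))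

      -- Descending induction on N, driven by k: when k = 0, N exceeds D and the slice has no
      -- support. For fixed N, `up-to` is complete induction on a.
      slices-vanish : ∀ k N → D < N ℕ.+ k → 1 ≤ N → ∀ a v → slice a N y v ≡ 0ℚ
      slices-vanish zero N D<N 1≤N a v with slice a N y v ℚP.≟ 0ℚ
      ... | yes z = z
      ... | no nz with slice-support a N supp v nz
      ...   | _ , refl , _ = contradiction D<N
        (ℕP.≤⇒≯ (subst (_≤ N ℕ.+ sum v) (sym (ℕP.+-identityʳ N)) (ℕP.m≤m+n N (sum v))))
      slices-vanish (suc k) N D<N+k 1≤N a v = up-to (suc a) a ℕP.≤-refl v
        where
          above : ∀ M p r → N < M → slice p M y r ≡ 0ℚ
          above M p r N<M = slices-vanish k M
            (ℕP.<-≤-trans D<N+k (subst (_≤ M ℕ.+ k) (sym (ℕP.+-suc N k)) (ℕP.+-monoˡ-≤ k N<M)))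
            (ℕP.≤-trans 1≤N (ℕP.<⇒≤ N<M)) p r
          up-to : ∀ m a → a < m → ∀ v → slice a N y v ≡ 0ℚ
          up-to (suc m) a a<1+m = bottom-up N a 1≤N above
            (λ p r p<a → up-to m p (ℕP.<-≤-trans p<a (ℕP.≤-pred a<1+m)) r)

      from-slices : ∀ w → IsMonomial D ℓ w → y w ≡ 0ℚ
      from-slices []      (refl , _) = contradiction 1≤ℓ λ ()
      from-slices (x ∷ v) (_ , refl , 1≤x ∷ _) =
        trans (sym (slice-one x y v 1≤x (ℕP.≤-trans (ℕP.m≤m+n x (sum v)) D≤B)))
          (slices-vanish (suc D) x (ℕP.m≤n+m (suc D) x) 1≤x 1 v)

-- Admissible sequences and partitions

Decreasing : Word → Set
Decreasing = AllPairs _≥_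

-- Deleting the first column of the diagram of this word leaves t, followed by r empty rows.
tailWord : Word → ℕ → Word
tailWord t r = map suc t ++ replicate r 1

length-tailWord : ∀ t r → length (tailWord t r) ≡ length t ℕ.+ r
length-tailWord t r = trans (length-++ (map suc t))
  (cong₂ ℕ._+_ (length-map suc t) (length-replicate r))

sum-tailWord : ∀ t r → sum (tailWord t r) ≡ sum t ℕ.+ length t ℕ.+ r
sum-tailWord [] zero    = refl
sum-tailWord [] (suc r) = cong suc (sum-tailWord [] r)
sum-tailWord (x ∷ t) r = trans (cong (suc x ℕ.+_) (sum-tailWord t r))
  (rearrange x (sum t) (length t) r)
  where
    rearrange : ∀ x s l r → suc (x ℕ.+ (s ℕ.+ l ℕ.+ r)) ≡ x ℕ.+ s ℕ.+ suc l ℕ.+ r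
    rearrange = solve-∀

-- The partition obtained by decreasing all parts of the word by 1 has, if z > 0, an outer hook of
-- arm z - 1 and leg length t; removing it leaves the partition coming from t.
data Encodes : Word → List (ℕ × ℕ) → Set where
  []    : Encodes [] []
  block : ∀ {t σ d} z r → All (_≤ z) t → d ≡ z ℕ.+ length t ℕ.+ suc r → Encodes t σ →
          Encodes (suc z ∷ tailWord t r) ((d , suc r) ∷ σ)

encodes-positive : ∀ {w σ} → Encodes w σ → All (1 ≤_) w
encodes-positive []                = []
encodes-positive (block {t} z r _ _ _) =
  s≤s z≤n ∷ AllP.++⁺ (AllP.map⁺ (All.universal (λ _ → s≤s z≤n) t)) (AllP.replicate⁺ r (s≤s z≤n))

replicate-decreasing : ∀ r x → Decreasing (replicate r x)
replicate-decreasing zero    x = []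
replicate-decreasing (suc r) x = AllP.replicate⁺ r ℕP.≤-refl ∷ replicate-decreasing r x

tailWord-bounded : ∀ {t} r z → All (_≤ z) t → All (_≤ suc z) (tailWord t r)
tailWord-bounded r z h = AllP.++⁺ (AllP.map⁺ (All.map s≤s h)) (AllP.replicate⁺ r (s≤s z≤n))

encodes-decreasing : ∀ {w σ} → Encodes w σ → Decreasing w
encodes-decreasing [] = []
encodes-decreasing (block {t} z r t≤z _ enc) = tailWord-bounded r z t≤z ∷
  AllPairsP.++⁺ (AllPairsP.map⁺ (AllPairs.map s≤s (encodes-decreasing enc))) (replicate-decreasing r 1)
    (AllP.map⁺ (All.universal (λ _ → AllP.replicate⁺ r (s≤s z≤n)) t))

encodes-length : ∀ {w σ} → Encodes w σ → length w ≡ sum (map proj₂ σ)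
encodes-length [] = refl
encodes-length (block {t} z r _ _ enc) = cong suc (trans (length-tailWord t r)
  (trans (ℕP.+-comm (length t) r) (cong (r ℕ.+_) (encodes-length enc))))

encodes-sum : ∀ {w σ} → Encodes w σ → sum w ≡ sum (map proj₁ σ)
encodes-sum [] = refl
encodes-sum (block {t} z r _ refl enc) rewrite sym (encodes-sum enc) =
  trans (cong (suc z ℕ.+_) (sum-tailWord t r))
    (rearrange z (sum t) (length t) r)
  where
    rearrange : ∀ z s l r → suc (z ℕ.+ (s ℕ.+ l ℕ.+ r)) ≡ z ℕ.+ l ℕ.+ suc r ℕ.+ s
    rearrange = solve-∀

encodes-parts : ∀ {w σ} → Encodes w σ → All (λ p → 1 ≤ proj₂ p × proj₂ p ≤ proj₁ p) σ
encodes-parts [] = []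
encodes-parts (block {t} z r _ refl enc) =
  (s≤s z≤n , ℕP.m≤n+m (suc r) (z ℕ.+ length t)) ∷ encodes-parts enc

-- The leading degree is the first letter plus the number of letters minus one, that is, the hook
-- length of the corner cell of the whole word.
block-length : ∀ z t r → z ℕ.+ length (suc z ∷ tailWord t r) ≡ z ℕ.+ length t ℕ.+ suc r
block-length z t r = trans (cong (λ l → z ℕ.+ suc l) (length-tailWord t r))
  (rearrange z (length t) r)
  where
    rearrange : ∀ z l r → z ℕ.+ suc (l ℕ.+ r) ≡ z ℕ.+ l ℕ.+ suc r
    rearrange = solve-∀

-- If t begins with z₂ + 1, the leading degree of its sequence is z₂ + length t by `block-length`.
-- The gap condition thus reduces to z₂ < z, which says that the first letter of t is at most z.
encodes-gap : ∀ {w σ} → Encodes w σ → Linked Gap σ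
encodes-gap [] = []
encodes-gap (block z r t≤z refl enc) = link enc t≤z (encodes-gap enc)
  where
    link : ∀ {t σ} → Encodes t σ → All (_≤ z) t → Linked Gap σ →
      Linked Gap ((z ℕ.+ length t ℕ.+ suc r , suc r) ∷ σ)
    link [] _ _ = [-]
    link (block {t} z₂ r₂ _ refl _) (z₂<z ∷ _) linked = ℕP.+-monoˡ-< (suc r)
      (subst (_< z ℕ.+ suc (length (tailWord t r₂))) (block-length z₂ t r₂)
        (ℕP.+-monoˡ-< (suc (length (tailWord t r₂))) z₂<z)) ∷ linked

encodes-admissible : ∀ {d ℓ w σ} → 1 ≤ ℓ → IsMonomial d ℓ w → Encodes w σ → Admissible d ℓ σ
encodes-admissible 1≤ℓ (refl , refl , _) enc =
  (λ { refl → nonempty 1≤ℓ enc }) , sym (encodes-sum enc) , sym (encodes-length enc) , encodes-gap enc ,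
  (λ p lst → Maybe.drop-just (subst (Maybe.All _) lst (AllP.last⁺ (All.map proj₂ (encodes-parts enc))))) ,
  All.map proj₁ (encodes-parts enc)
  where
    nonempty : ∀ {w} → 1 ≤ length w → ¬ Encodes w []
    nonempty () []

-- This is what placing a further block in front of t requires: a bound on the letters of t in terms
-- of the leading degree d.
tailWord-bound-head : ∀ {t σ d p} → Encodes t ((d , p) ∷ σ) →
  ∃[ z ] All (_≤ suc z) t × d ≡ z ℕ.+ length t
tailWord-bound-head (block {t} z r t≤z refl _) = z , ℕP.≤-refl ∷ tailWord-bounded r z t≤z ,
  sym (block-length z t r)

encode : ∀ σ → Linked Gap σ → (∀ p → last σ ≡ just p → proj₂ p ≤ proj₁ p) →
  All (λ p → 1 ≤ proj₂ p) σ → ∃[ w ] Encodes w σ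
encode [] _ _ _ = [] , []
-- In the last block t is empty, and the subtraction d - (r + 1) is exact because `lst` gives r + 1
-- ≤ d.
encode ((d , suc r) ∷ []) _ lst (_ ∷ _) = _ , block (d ℕ.∸ suc r) r []
  (sym (trans (cong (ℕ._+ suc r) (ℕP.+-identityʳ (d ℕ.∸ suc r))) (ℕP.m∸n+n≡m (lst _ refl)))) []
encode ((d , suc r) ∷ σ@((d₂ , p₂) ∷ _)) (gap ∷ linked) lst (_ ∷ all) with encode σ linked lst all
... | t , enc with tailWord-bound-head enc
...   | z₂ , t≤ , refl = _ , block z r (All.map (λ x≤ → ℕP.≤-trans x≤ z₂<z) t≤) (sym z-def) enc
  where
    d₂+p = length t ℕ.+ suc r
    gap' : suc z₂ ℕ.+ d₂+p ≤ d
    gap' = subst (λ m → suc m ≤ d) (ℕP.+-assoc z₂ (length t) (suc r)) gap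
    -- The equation d = z + length t + (r + 1) forces z. By the gap condition z exceeds z₂, so the
    -- letters of t, being at most z₂ + 1, are at most z.
    z = d ℕ.∸ d₂+p
    z-def : z ℕ.+ length t ℕ.+ suc r ≡ d
    z-def = trans (ℕP.+-assoc z (length t) (suc r))
      (ℕP.m∸n+n≡m (ℕP.≤-trans (ℕP.m≤n+m d₂+p (suc z₂)) gap'))
    z₂<z : z₂ < z
    z₂<z = subst (_≤ z) (ℕP.m+n∸n≡m (suc z₂) d₂+p) (ℕP.∸-monoˡ-≤ d₂+p gap')

encodes-injective : ∀ {w w' σ} → Encodes w σ → Encodes w' σ → w ≡ w'
encodes-injective [] [] = refl
encodes-injective (block {t} z r _ refl enc) (block z' .r _ e enc') with encodes-injective enc enc'
... | refl with ℕP.+-cancelʳ-≡ (length t) z z' (ℕP.+-cancelʳ-≡ (suc r) _ _ e)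
...   | refl = refl

-- Inverse to `tailWord` on decreasing words of positive letters: there a first letter 1 means that
-- only ones follow. The clause for the letter 0 is a default.
split : Word → Word × ℕ
split []                = [] , 0
split (zero ∷ w)        = [] , 0
split (suc zero ∷ w)    = [] , suc (length w)
split (suc (suc x) ∷ w) = suc x ∷ proj₁ (split w) , proj₂ (split w)

split-tailWord : ∀ {t} r → All (1 ≤_) t → split (tailWord t r) ≡ (t , r)
split-tailWord zero    [] = refl
split-tailWord (suc r) [] = cong (λ l → [] , suc l) (length-replicate r)
split-tailWord r (s≤s {n = x} z≤n ∷ h) rewrite split-tailWord r h = refl

≡-replicate : ∀ {w} → All (1 ≤_) w → All (_≤ 1) w → w ≡ replicate (length w) 1
≡-replicate [] [] = refl
≡-replicate (1≤x ∷ h) (x≤1 ∷ k) = cong₂ _∷_ (ℕP.≤-antisym x≤1 1≤x) (≡-replicate h k)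

tailWord-surjective : ∀ {w} → Decreasing w → All (1 ≤_) w → ∃[ t ] ∃[ r ] All (1 ≤_) t × w ≡ tailWord t r
tailWord-surjective [] [] = [] , 0 , [] , refl
tailWord-surjective {suc zero ∷ w} (w≤1 ∷ _) (_ ∷ pos) =
  [] , suc (length w) , [] , cong (1 ∷_) (≡-replicate pos w≤1)
tailWord-surjective {suc (suc x) ∷ w} (_ ∷ dec) (_ ∷ pos) with tailWord-surjective dec pos
... | t , r , pos-t , refl = suc x ∷ t , r , s≤s z≤n ∷ pos-t , refl

-- The first argument bounds the recursion depth.
decode : ℕ → Word → List (ℕ × ℕ)
decode n       []      = []
decode zero    (h ∷ w) = []
-- With h = z + 1 this first component is the d of `block`.
decode (suc n) (h ∷ w) = (h ℕ.+ length t ℕ.+ r , suc r) ∷ decode n t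
  where
    t = proj₁ (split w)
    r = proj₂ (split w)

decode-encodes : ∀ n {w} → length w ≤ n → Decreasing w → All (1 ≤_) w → Encodes w (decode n w)
decode-encodes n _ [] [] = []
decode-encodes (suc n) {suc z ∷ w} (s≤s len) (w≤ ∷ dec) (_ ∷ pos) with tailWord-surjective dec pos
... | t , r , pos-t , refl rewrite split-tailWord r pos-t =
  block z r (All.map ℕP.≤-pred (AllP.map⁻ (AllP.++⁻ˡ (map suc t) w≤))) (sym (ℕP.+-suc (z ℕ.+ length t) r))
    (decode-encodes n
      (ℕP.≤-trans (ℕP.m≤m+n (length t) r) (subst (_≤ n) (length-tailWord t r) len))
      (AllPairs.map ℕP.≤-pred (AllPairsP.map⁻ (proj₁ (++-decreasing (map suc t) dec)))) pos-t)
  where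
    ++-decreasing : ∀ u {v} → Decreasing (u ++ v) → Decreasing u × Decreasing v
    ++-decreasing []      d = [] , d
    ++-decreasing (x ∷ u) (h ∷ d) with ++-decreasing u d
    ... | du , dv = AllP.++⁻ˡ u h ∷ du , dv

encodes-decode : ∀ n {w σ} → length w ≤ n → Encodes w σ → decode n w ≡ σ
encodes-decode n       _         [] = refl
encodes-decode (suc n) (s≤s len) (block {t} z r _ refl enc) rewrite split-tailWord r (encodes-positive enc) =
  cong₂ _∷_ (cong (_, suc r) (sym (ℕP.+-suc (z ℕ.+ length t) r)))
    (encodes-decode n (ℕP.≤-trans (ℕP.m≤m+n (length t) r) (subst (_≤ n) (length-tailWord t r) len)) enc)

-- Linear algebra

pivot : ∀ (x : A) (es : List (A → ℚ)) → All (λ e → e x ≡ 0ℚ) es ⊎ ∃[ e ] ∃[ rest ] es ↭ e ∷ rest × e x ≢ 0ℚ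
pivot x [] = inj₁ []
pivot x (e ∷ es) with e x ℚP.≟ 0ℚ
... | no  ex≢0 = inj₂ (e , es , ↭-refl , ex≢0)
... | yes ex≡0 with pivot x es
...   | inj₁ all = inj₁ (ex≡0 ∷ all)
...   | inj₂ (e' , rest , es↭ , e'x≢0) = inj₂ (e' , e ∷ rest ,
  ↭-trans (prep e es↭) (swap e e' ↭-refl) , e'x≢0)

-- Gaussian elimination, with one unknown for each entry of xs and one equation for each e. If no
-- equation involves the first unknown, it is set to 1 and the others to 0. Otherwise a pivot
-- equation eliminates it from the rest and finally determines its value.
underdetermined : ∀ (xs : List A) (es : List (A → ℚ)) → length es < length xs →
  ∃[ ys ] map proj₂ ys ≡ xs × Any (λ t → proj₁ t ≢ 0ℚ) ys × All (λ e → eval e ys ≡ 0ℚ) es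
underdetermined [] es ()
underdetermined {A} (x ∷ xs) es len with pivot x es
... | inj₁ zeros = (1ℚ , x) ∷ map (0ℚ ,_) xs , cong (x ∷_) (trans (sym (map-∘ xs)) (map-id xs)) , here (λ ()) ,
  All.map (λ {e} ex≡0 → trans (cong₂ _+_ (trans (ℚP.*-identityˡ (e x)) ex≡0)
    (trans (∑-map (0ℚ ,_) xs (λ t → proj₁ t * e (proj₂ t))) (∑-zero xs (λ {z} _ → ℚP.*-zeroˡ (e z))))) refl) zeros
... | inj₂ (e , rest , es↭ , ex≢0)
  with underdetermined xs (map (λ (f : A → ℚ) z → f z - f x * ℚ.1/_ (e x) {{ℚ.≢-nonZero ex≢0}} * e z) rest)
         (ℕP.≤-pred (subst (_< suc (length xs))
           (trans (↭-length es↭) (cong suc (sym (length-map _ rest)))) len))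
...   | ys , refl , nontrivial , solves =
  (y₀ , x) ∷ ys , refl , there nontrivial ,
  All-resp-↭ (↭-sym es↭) (pivot-solved ∷ All.map rest-solved (AllP.map⁻ solves))
  where
    instance
      ex-nonZero : ℚ.NonZero (e x)
      ex-nonZero = ℚ.≢-nonZero ex≢0

    i = ℚ.1/ (e x)
    y₀ = - (eval e ys * i)

    pivot-solved : y₀ * e x + eval e ys ≡ 0ℚ
    pivot-solved = trans
      (solve 3 (λ c i k → (:- (c :* i)) :* k :+ c := c :* (con 1ℚ :- i :* k)) refl (eval e ys) i (e x))
      (trans (cong (λ t → eval e ys * (1ℚ - t)) (ℚP.*-inverseˡ (e x))) (ℚP.*-zeroʳ (eval e ys)))

    rest-solved : ∀ {f} → eval (λ z → f z - f x * i * e z) ys ≡ 0ℚ → y₀ * f x + eval f ys ≡ 0ℚ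
    rest-solved {f} h = begin
      y₀ * f x + eval f ys
        ≡⟨ solve 4 (λ c i f F → (:- (c :* i)) :* f :+ F := F :- f :* i :* c) refl (eval e ys) i (f x) (eval f ys) ⟩
      eval f ys - f x * i * eval e ys
        ≡⟨ cong (λ t → eval f ys - t) (∑-*ˡ ys (f x * i) _) ⟨
      eval f ys - ∑[ t ∈ ys ] (f x * i * (proj₁ t * e (proj₂ t)))
        ≡⟨ ∑-- ys _ _ ⟨
      ∑[ t ∈ ys ] (proj₁ t * f (proj₂ t) - f x * i * (proj₁ t * e (proj₂ t)))
        ≡⟨ ∑-cong ys (λ t → solve 4 (λ c f k e → c :* f :- k :* (c :* e) := c :* (f :- k :* e)) refl
             (proj₁ t) (f (proj₂ t)) (f x * i) (e (proj₂ t))) ⟩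
      eval (λ z → f z - f x * i * e z) ys
        ≡⟨ h ⟩
      0ℚ ∎
      where open ≡-Reasoning

∑-single : ∀ {R : A → A → Set} → (∀ {s t} → R s t → R t s) →
  ∀ {xs t} (f : A → ℚ) → AllPairs R xs → t ∈ xs → (∀ {s} → s ∈ xs → R s t → f s ≡ 0ℚ) → ∑ xs f ≡ f t
∑-single R-sym {t ∷ xs} f (R-t ∷ _) (here refl) h = trans
  (cong (f t +_) (∑-zero xs (λ s∈ → h (there s∈) (R-sym (All.lookup R-t s∈)))))
  (ℚP.+-identityʳ (f t))
∑-single R-sym {x ∷ xs} f (R-x ∷ pairs) (there t∈) h = trans
  (cong₂ _+_ (h (here refl) (All.lookup R-x t∈)) (∑-single R-sym f pairs t∈ (h ∘ there)))
  (ℚP.+-identityˡ _)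

-- Coefficients found for the products `gProd σ` are hereby attached to the sequences σ themselves.
pairs-of-map : ∀ (h : A → B) xs (ys : List (ℚ × B)) → map proj₂ ys ≡ map h xs →
  ∃[ cs ] map proj₂ cs ≡ xs × map (λ t → proj₁ t , h (proj₂ t)) cs ≡ ys
pairs-of-map h [] [] _ = [] , refl , refl
pairs-of-map h (x ∷ xs) ((c , _) ∷ ys) e with ∷-injective e
... | refl , e' with pairs-of-map h xs ys e'
...   | cs , refl , refl = (c , x) ∷ cs , refl , refl

-- Coefficients as functionals

open Sort ℕP.≤-decTotalOrder using (sort; sort-↭; sort-↗)
open Sort (Flip.decTotalOrder ℕP.≤-decTotalOrder)
  renaming (sort to sort≥; sort-↭ to sort≥-↭; sort-↗ to sort≥-↗)

sort-cong : ∀ {u v} → u ↭ v → sort u ≡ sort v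
sort-cong {u} {v} u↭v = Pointwise-≡⇒≡ (↗↭↗⇒≋ ℕP.≤-totalOrder (sort-↗ u) (sort-↗ v)
  (↭⇒↭ₛ (↭-trans (sort-↭ u) (↭-trans u↭v (↭-sym (sort-↭ v))))))

sort-≡⇒↭ : ∀ {u v} → sort u ≡ sort v → u ↭ v
sort-≡⇒↭ {u} {v} e = ↭-trans (↭-sym (sort-↭ u)) (↭-trans (↭-reflexive e) (sort-↭ v))

sort≥-decreasing : ∀ w → Decreasing (sort≥ w)
sort≥-decreasing w = Linked⇒AllPairs (λ p q → ℕP.≤-trans q p) (sort≥-↗ w)

decreasing-unique : ∀ {u v} → Decreasing u → Decreasing v → u ↭ v → u ≡ v
decreasing-unique du dv u↭v = Pointwise-≡⇒≡ (↗↭↗⇒≋ (Flip.totalOrder ℕP.≤-totalOrder)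
  (AllPairs⇒Linked du) (AllPairs⇒Linked dv) (↭⇒↭ₛ u↭v))

[_≡?_] : Word → Word → ℚ
[ u ≡? v ] with ≡-dec ℕP._≟_ u v
... | yes _ = 1ℚ
... | no  _ = 0ℚ

indicator : Word → Word → ℚ
indicator m w = [ sort w ≡? sort m ]

indicator-refl : ∀ m → indicator m m ≡ 1ℚ
indicator-refl m with ≡-dec ℕP._≟_ (sort m) (sort m)
... | yes _ = refl
... | no ne = contradiction refl ne

indicator≢0⇒↭ : ∀ m w → indicator m w ≢ 0ℚ → w ↭ m
indicator≢0⇒↭ m w h with ≡-dec ℕP._≟_ (sort w) (sort m)
... | yes e = sort-≡⇒↭ e
... | no  _ = contradiction refl h

indicator-symmetric : ∀ m → Symmetric (indicator m)
indicator-symmetric m u↭v = cong [_≡? sort m ] (sort-cong u↭v)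

indicator-cong : ∀ {m n} w → m ↭ n → indicator m w ≡ indicator n w
indicator-cong w m↭n = cong [ sort w ≡?_] (sort-cong m↭n)

coeff-eval : ∀ p m → coeff p m ≡ eval (indicator m) p
coeff-eval [] m = refl
coeff-eval ((c , w) ∷ p) m with ≡-dec ℕP._≟_ (sort w) (sort m)
... | yes _ = cong₂ _+_ (sym (ℚP.*-identityʳ c)) (coeff-eval p m)
... | no  _ = trans (coeff-eval p m) (sym (trans (cong (_+ eval (indicator m) p) (ℚP.*-zeroʳ c)) (ℚP.+-identityˡ _)))

monomial-resp-↭ : ∀ {d ℓ u v} → u ↭ v → IsMonomial d ℓ u → IsMonomial d ℓ v
monomial-resp-↭ u↭v (len , sm , all) =
  trans (sym (↭-length u↭v)) len , trans (sym (sum-↭ u↭v)) sm , All-resp-↭ u↭v all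

monomial? : ∀ d ℓ w → Dec (IsMonomial d ℓ w)
monomial? d ℓ w = (length w ℕP.≟ ℓ) ×-dec (sum w ℕP.≟ d) ×-dec All.all? (1 ℕP.≤?_) w

∈-compositions⁻ : ∀ d ℓ {w} → w ∈ compositions d ℓ → IsMonomial d ℓ w
∈-compositions⁻ zero zero (here refl) = refl , refl , []
∈-compositions⁻ d (suc ℓ) {w} w∈
  with find (∈-concatMap⁻ (λ j → map (suc j ∷_) (compositions (d ℕ.∸ suc j) ℓ)) {xs = upTo d}
         (subst (w ∈_) (compositions-suc d ℓ) w∈))
... | j , j∈ , w∈' with ∈-map⁻ (suc j ∷_) w∈'
...   | v , v∈ , refl with ∈-compositions⁻ (d ℕ.∸ suc j) ℓ v∈
...     | len , sm , all = cong suc len , trans (cong (suc j ℕ.+_) sm) (ℕP.m+[n∸m]≡n (∈-upTo⁻ j∈)) , s≤s z≤n ∷ all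

∈-compositions⁺ : ∀ {d ℓ w} → IsMonomial d ℓ w → w ∈ compositions d ℓ
∈-compositions⁺ {w = []} (refl , refl , _) = here refl
∈-compositions⁺ {d} {w = suc j ∷ w} (refl , refl , _ ∷ all) =
  subst (suc j ∷ w ∈_) (sym (compositions-suc (suc j ℕ.+ sum w) (length w)))
    (∈-concatMap⁺ (λ i → map (suc i ∷_) (compositions (suc j ℕ.+ sum w ℕ.∸ suc i) (length w)))
      (lose (∈-upTo⁺ (s≤s (ℕP.m≤m+n j (sum w))))
        (∈-map⁺ (suc j ∷_) (∈-compositions⁺ (refl , sym (ℕP.m+n∸m≡n (suc j) (sum w)) , all)))))

InF-gProd : ∀ σ → InF (sum (map proj₁ σ)) (sum (map proj₂ σ)) (gProd σ)
InF-gProd [] = (refl , refl , []) ∷ []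
InF-gProd ((d , p) ∷ σ) = AllP.concat⁺ (AllP.map⁺ (AllP.map⁺ (All.tabulate (λ {u} u∈ →
  AllP.map⁺ (All.map (append (∈-compositions⁻ d p u∈)) (InF-gProd σ))))))
  where
    append : ∀ {d ℓ d' ℓ' u v} → IsMonomial d ℓ u → IsMonomial d' ℓ' v → IsMonomial (d ℕ.+ d') (ℓ ℕ.+ ℓ') (u ++ v)
    append {u = u} {v} (refl , refl , a) (refl , refl , b) = length-++ u , sum-++ u v , AllP.++⁺ a b

coeff-InF : ∀ {d ℓ p} m → InF d ℓ p → ¬ IsMonomial d ℓ m → coeff p m ≡ 0ℚ
coeff-InF {p = p} m inF ¬mon = trans (coeff-eval p m) (∑-zero p term)
  where
    term : ∀ {t} → t ∈ p → proj₁ t * indicator m (proj₂ t) ≡ 0ℚ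
    term {c , w} t∈ with indicator m w ℚP.≟ 0ℚ
    ... | yes z = trans (cong (c *_) z) (ℚP.*-zeroʳ c)
    ... | no nz = contradiction (monomial-resp-↭ (indicator≢0⇒↭ m w nz) (All.lookup inF t∈)) ¬mon

coeff-linComb : ∀ cs m → coeff (linComb cs) m ≡ eval (λ σ → coeff (gProd σ) m) cs
coeff-linComb [] m = refl
coeff-linComb ((c , σ) ∷ cs) m = begin
  coeff ((c ·P gProd σ) ++ linComb cs) m
    ≡⟨ coeff-eval ((c ·P gProd σ) ++ linComb cs) m ⟩
  eval (indicator m) ((c ·P gProd σ) ++ linComb cs)
    ≡⟨ ∑-++ (c ·P gProd σ) (linComb cs) _ ⟩
  eval (indicator m) (c ·P gProd σ) + eval (indicator m) (linComb cs)
    ≡⟨ cong₂ _+_ scaled (trans (sym (coeff-eval (linComb cs) m)) (coeff-linComb cs m)) ⟩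
  c * coeff (gProd σ) m + eval (λ σ → coeff (gProd σ) m) cs ∎
  where
    open ≡-Reasoning
    scaled : eval (indicator m) (c ·P gProd σ) ≡ c * coeff (gProd σ) m
    scaled = trans (∑-map _ (gProd σ) _)
      (trans (∑-cong (gProd σ) (λ t → ℚP.*-assoc c (proj₁ t) (indicator m (proj₂ t))))
        (trans (∑-*ˡ (gProd σ) c _) (cong (c *_) (sym (coeff-eval (gProd σ) m)))))

eval-swap : ∀ {A B : Set} (f : A → B → ℚ) (xs : List (ℚ × A)) (ys : List (ℚ × B)) →
  eval (λ a → eval (f a) ys) xs ≡ eval (λ b → eval (λ a → f a b) xs) ys
eval-swap f xs ys = begin
  ∑[ s ∈ xs ] (proj₁ s * ∑[ t ∈ ys ] (proj₁ t * f (proj₂ s) (proj₂ t)))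
    ≡⟨ ∑-cong xs (λ s → ∑-*ˡ ys (proj₁ s) _) ⟨
  ∑[ s ∈ xs ] ∑[ t ∈ ys ] (proj₁ s * (proj₁ t * f (proj₂ s) (proj₂ t)))
    ≡⟨ ∑-swap xs ys _ ⟩
  ∑[ t ∈ ys ] ∑[ s ∈ xs ] (proj₁ s * (proj₁ t * f (proj₂ s) (proj₂ t)))
    ≡⟨ ∑-cong ys (λ t → ∑-cong xs (λ s →
         solve 3 (λ a b c → a :* (b :* c) := b :* (a :* c)) refl (proj₁ s) (proj₁ t) (f (proj₂ s) (proj₂ t)))) ⟩
  ∑[ t ∈ ys ] ∑[ s ∈ xs ] (proj₁ t * (proj₁ s * f (proj₂ s) (proj₂ t)))
    ≡⟨ ∑-cong ys (λ t → ∑-*ˡ xs (proj₁ t) _) ⟩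
  ∑[ t ∈ ys ] (proj₁ t * ∑[ s ∈ xs ] (proj₁ s * f (proj₂ s) (proj₂ t))) ∎
  where open ≡-Reasoning

-- Independence and spanning by a dimension count

AllPairs-map-All : ∀ {A : Set} {P : A → Set} {R S : A → A → Set} →
  (∀ {x y} → P x → P y → R x y → S x y) → ∀ {xs} → All P xs → AllPairs R xs → AllPairs S xs
AllPairs-map-All h [] [] = []
AllPairs-map-All h (px ∷ all) (rx ∷ pairs) =
  All.zipWith (λ (py , r) → h px py r) (all , rx) ∷ AllPairs-map-All h all pairs

Distinct : ∀ {A : Set} → List (ℚ × A) → Set
Distinct = AllPairs (λ s t → proj₂ s ≢ proj₂ t)

module Basis (d ℓ : ℕ) (1≤ℓ : 1 ≤ ℓ) where

  -- One decreasing word per monomial: the list is at once the standard basis of F(d,ℓ) and the set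
  -- of partitions of d into ℓ parts.
  monomials : List Word
  monomials = deduplicate (≡-dec ℕP._≟_) (map sort≥ (compositions d ℓ))

  monomials-unique : Unique monomials
  monomials-unique = deduplicate-! (≡-dec ℕP._≟_) (map sort≥ (compositions d ℓ))

  ∈-monomials⁻ : ∀ {w} → w ∈ monomials → Decreasing w × IsMonomial d ℓ w
  ∈-monomials⁻ w∈ with ∈-map⁻ sort≥ (∈-deduplicate⁻ (≡-dec ℕP._≟_) (map sort≥ (compositions d ℓ)) w∈)
  ... | u , u∈ , refl = sort≥-decreasing u , monomial-resp-↭ (↭-sym (sort≥-↭ u)) (∈-compositions⁻ d ℓ u∈)

  sort≥-∈-monomials : ∀ {m} → IsMonomial d ℓ m → sort≥ m ∈ monomials
  sort≥-∈-monomials mon = ∈-deduplicate⁺ (≡-dec ℕP._≟_) (∈-map⁺ sort≥ (∈-compositions⁺ mon))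

  decreasing-∈-monomials : ∀ {w} → Decreasing w → IsMonomial d ℓ w → w ∈ monomials
  decreasing-∈-monomials {w} dec mon = subst (_∈ monomials)
    (decreasing-unique (sort≥-decreasing w) dec (sort≥-↭ w)) (sort≥-∈-monomials mon)

  -- Being an image of `monomials`, this list has as many entries as F(d,ℓ) has dimensions.
  admissibles : List (List (ℕ × ℕ))
  admissibles = map (decode ℓ) monomials

  decode-monomial : ∀ {w} → w ∈ monomials → Encodes w (decode ℓ w)
  decode-monomial w∈ with ∈-monomials⁻ w∈
  ... | dec , refl , _ , pos = decode-encodes ℓ ℕP.≤-refl dec pos

  ∈-admissibles⁻ : ∀ {σ} → σ ∈ admissibles → Admissible d ℓ σ
  ∈-admissibles⁻ σ∈ with ∈-map⁻ (decode ℓ) σ∈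
  ... | w , w∈ , refl = encodes-admissible 1≤ℓ (proj₂ (∈-monomials⁻ w∈)) (decode-monomial w∈)

  ∈-admissibles⁺ : ∀ {σ} → Admissible d ℓ σ → σ ∈ admissibles
  ∈-admissibles⁺ {σ} (_ , sum-d , sum-ℓ , linked , lst , all) with encode σ linked lst all
  ... | w , enc = subst (_∈ admissibles) (encodes-decode ℓ (ℕP.≤-reflexive len) enc)
    (∈-map⁺ (decode ℓ) (decreasing-∈-monomials (encodes-decreasing enc)
      (len , trans (encodes-sum enc) sum-d , encodes-positive enc)))
    where
      len : length w ≡ ℓ
      len = trans (encodes-length enc) sum-ℓ

  admissibles-unique : Unique admissibles
  admissibles-unique = AllPairsP.map⁺ (AllPairs-map-All
    (λ {u} {v} enc-u enc-v u≢v e → u≢v (encodes-injective enc-u (subst (Encodes v) (sym e) enc-v)))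
    (All.tabulate decode-monomial) monomials-unique)

  InF-admissible : ∀ {σ} → Admissible d ℓ σ → InF d ℓ (gProd σ)
  InF-admissible {σ} (_ , refl , refl , _) = InF-gProd σ

  -- A word is either a rearrangement of an entry of `monomials`, with the same coefficients, or no
  -- monomial of F(d,ℓ), and then both coefficients are zero.
  ≈-from-monomials : ∀ cs f → All (λ t → Admissible d ℓ (proj₂ t)) cs → InF d ℓ f →
    (∀ {m} → m ∈ monomials → eval (λ σ → coeff (gProd σ) m) cs ≡ coeff f m) → linComb cs ≈ f
  ≈-from-monomials cs f adm inF h m with monomial? d ℓ m
  ... | yes mon = begin
    coeff (linComb cs) m              ≡⟨ coeff-eval (linComb cs) m ⟩
    eval (indicator m) (linComb cs)   ≡⟨ ∑-cong (linComb cs) (λ t → cong (proj₁ t *_) (indicator-cong (proj₂ t) m↭)) ⟩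
    eval (indicator m') (linComb cs)  ≡⟨ coeff-eval (linComb cs) m' ⟨
    coeff (linComb cs) m'             ≡⟨ coeff-linComb cs m' ⟩
    eval (λ σ → coeff (gProd σ) m') cs ≡⟨ h (sort≥-∈-monomials mon) ⟩
    coeff f m'                        ≡⟨ coeff-eval f m' ⟩
    eval (indicator m') f             ≡⟨ ∑-cong f (λ t → cong (proj₁ t *_) (indicator-cong (proj₂ t) m↭)) ⟨
    eval (indicator m) f              ≡⟨ coeff-eval f m ⟨
    coeff f m                         ∎
    where
      open ≡-Reasoning
      m' = sort≥ m
      m↭ = ↭-sym (sort≥-↭ m)
  ... | no ¬mon = trans (coeff-linComb cs m)
    (trans (∑-zero cs (λ {t} t∈ → trans
        (cong (proj₁ t *_) (coeff-InF m (InF-admissible (All.lookup adm t∈)) ¬mon)) (ℚP.*-zeroʳ (proj₁ t))))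
      (sym (coeff-InF m inF ¬mon)))

  module _ (ys : Poly) (ys-monomials : map proj₂ ys ≡ monomials) where

    -- The functional with value c at m for each entry (c , m) of ys; it is defined on all words and
    -- depends only on their sorted form.
    dual : Word → ℚ
    dual w = eval (λ m → indicator m w) ys

    dual-symmetric : Symmetric dual
    dual-symmetric u↭v = ∑-cong ys (λ t → cong (proj₁ t *_) (indicator-symmetric (proj₂ t) u↭v))

    ∈-ys : ∀ {t} → t ∈ ys → proj₂ t ∈ monomials
    ∈-ys t∈ = subst (_ ∈_) ys-monomials (∈-map⁺ proj₂ t∈)

    dual-supported : ∀ w → dual w ≢ 0ℚ → IsMonomial d ℓ w
    dual-supported w h with ∑≢0⇒∃ ys h
    ... | (c , m) , t∈ , h' = monomial-resp-↭
      (↭-sym (indicator≢0⇒↭ m w (*≢0ʳ c (indicator m w) h'))) (proj₂ (∈-monomials⁻ (∈-ys t∈)))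

    eval-dual : ∀ p → eval dual p ≡ eval (coeff p) ys
    eval-dual p = trans (eval-swap (λ w m → indicator m w) p ys)
      (∑-cong ys (λ t → cong (proj₁ t *_) (sym (coeff-eval p (proj₂ t)))))

    dual-coefficient : ∀ {c m} → (c , m) ∈ ys → dual m ≡ c
    dual-coefficient {c} {m} t∈ = trans
      (∑-single {R = λ s t → proj₂ s ≢ proj₂ t} (λ ne → ne ∘ sym) (λ t → proj₁ t * indicator (proj₂ t) m)
        (AllPairsP.map⁻ (subst Unique (sym ys-monomials) monomials-unique)) t∈ others)
      (trans (cong (c *_) (indicator-refl m)) (ℚP.*-identityʳ c))
      where
        others : ∀ {s} → s ∈ ys → proj₂ s ≢ m → proj₁ s * indicator (proj₂ s) m ≡ 0ℚ
        others {c' , m'} s∈ m'≢m with indicator m' m ℚP.≟ 0ℚ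
        ... | yes z = trans (cong (c' *_) z) (ℚP.*-zeroʳ c')
        ... | no nz = contradiction
          (sym (decreasing-unique (proj₁ (∈-monomials⁻ (∈-ys t∈))) (proj₁ (∈-monomials⁻ (∈-ys s∈)))
            (indicator≢0⇒↭ m' m nz)))
          m'≢m

  -- The values of y on the basis monomials are unknowns, and each product in R imposes one linear
  -- equation on them, so a non-zero solution exists. Being linear, y respects every relation among
  -- the products.
  separating-functional : ∀ (R : List (List (ℕ × ℕ))) → length R < length monomials →
    ∃[ y ] Symmetric y × (∀ w → y w ≢ 0ℚ → IsMonomial d ℓ w) × (∃[ m ] y m ≢ 0ℚ)
      × (∀ {σ} → σ ∈ R → eval y (gProd σ) ≡ 0ℚ)
      × (∀ cs → (∀ {m} → m ∈ monomials → eval (λ σ → coeff (gProd σ) m) cs ≡ 0ℚ) →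
           eval (λ σ → eval y (gProd σ)) cs ≡ 0ℚ)
  separating-functional R len =
    let ys , ys-monomials , nontrivial , solves =
          underdetermined monomials (map (coeff ∘ gProd) R)
            (subst (_< length monomials) (sym (length-map (coeff ∘ gProd) R)) len)
        (c , m) , cm∈ , c≢0 = find nontrivial
    in dual ys ys-monomials , dual-symmetric ys ys-monomials , dual-supported ys ys-monomials ,
       (m , c≢0 ∘ trans (sym (dual-coefficient ys ys-monomials cm∈))) ,
       (λ {σ} σ∈ → trans (eval-dual ys ys-monomials (gProd σ)) (All.lookup (AllP.map⁻ solves) σ∈)) ,
       respects-relations ys ys-monomials
    where
      respects-relations : ∀ ys ys-monomials cs →
        (∀ {m} → m ∈ monomials → eval (λ σ → coeff (gProd σ) m) cs ≡ 0ℚ) →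
        eval (λ σ → eval (dual ys ys-monomials) (gProd σ)) cs ≡ 0ℚ
      respects-relations ys ys-monomials cs relation = begin
        eval (λ σ → eval (dual ys ys-monomials) (gProd σ)) cs
          ≡⟨ ∑-cong cs (λ t → cong (proj₁ t *_) (eval-dual ys ys-monomials (gProd (proj₂ t)))) ⟩
        eval (λ σ → eval (coeff (gProd σ)) ys) cs
          ≡⟨ eval-swap (coeff ∘ gProd) cs ys ⟩
        eval (λ m → eval (λ σ → coeff (gProd σ) m) cs) ys
          ≡⟨ ∑-zero ys (λ {t} t∈ → trans
               (cong (proj₁ t *_) (relation (∈-ys ys ys-monomials t∈))) (ℚP.*-zeroʳ (proj₁ t))) ⟩
        0ℚ ∎
        where open ≡-Reasoning

  -- Some non-zero functional kills all admissible products but gProd σ₀.  If c₀ were non-zero, the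
  -- relation would make it kill gProd σ₀ too.
  independent : ∀ cs → All (λ t → Admissible d ℓ (proj₂ t)) cs → Distinct cs →
    (∀ {m} → m ∈ monomials → eval (λ σ → coeff (gProd σ) m) cs ≡ 0ℚ) → All (λ t → proj₁ t ≡ 0ℚ) cs
  independent cs adm distinct relation = All.tabulate vanish
    where
      module _ {c₀ σ₀} (t∈ : (c₀ , σ₀) ∈ cs) (c₀≢0 : c₀ ≢ 0ℚ)
        (as bs : List (List (ℕ × ℕ))) (admissibles≡ : admissibles ≡ as ++ σ₀ ∷ bs)
        (y : Word → ℚ) (kills-rest : ∀ {σ} → σ ∈ as ++ bs → eval y (gProd σ) ≡ 0ℚ)
        (y-relation : eval (λ σ → eval y (gProd σ)) cs ≡ 0ℚ) where

        σ₀-or-rest : ∀ {σ} → Admissible d ℓ σ → σ ≡ σ₀ ⊎ σ ∈ as ++ bs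
        σ₀-or-rest {σ} adm-σ with ∈-++⁻ as (subst (σ ∈_) admissibles≡ (∈-admissibles⁺ adm-σ))
        ... | inj₁ σ∈as         = inj₂ (∈-++⁺ˡ σ∈as)
        ... | inj₂ (here σ≡σ₀)  = inj₁ σ≡σ₀
        ... | inj₂ (there σ∈bs) = inj₂ (∈-++⁺ʳ as σ∈bs)

        kills-others : ∀ {σ} → Admissible d ℓ σ → σ ≢ σ₀ → eval y (gProd σ) ≡ 0ℚ
        kills-others adm-σ σ≢σ₀ with σ₀-or-rest adm-σ
        ... | inj₁ σ≡σ₀ = contradiction σ≡σ₀ σ≢σ₀
        ... | inj₂ σ∈   = kills-rest σ∈

        kills-σ₀ : eval y (gProd σ₀) ≡ 0ℚ
        kills-σ₀ = *-zero-cases c₀ _ (trans (sym (∑-single {R = λ s t → proj₂ s ≢ proj₂ t} (λ ne → ne ∘ sym)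
          (λ t → proj₁ t * eval y (gProd (proj₂ t))) distinct t∈
          (λ {s} s∈ s≢ → trans (cong (proj₁ s *_) (kills-others (All.lookup adm s∈) s≢)) (ℚP.*-zeroʳ (proj₁ s)))))
          y-relation) c₀≢0

        kills : ∀ σ → Admissible d ℓ σ → eval y (gProd σ) ≡ 0ℚ
        kills σ adm-σ with σ₀-or-rest adm-σ
        ... | inj₁ refl = kills-σ₀
        ... | inj₂ σ∈   = kills-rest σ∈

      refute : ∀ {c₀ σ₀} → (c₀ , σ₀) ∈ cs → ¬ c₀ ≢ 0ℚ
      refute {c₀} {σ₀} t∈ c₀≢0 =
        let as , bs , admissibles≡ = ∈-∃++ (∈-admissibles⁺ (All.lookup adm t∈))
            y , y-sym , y-supp , (m , ym≢0) , kills-rest , y-relation =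
              -- Without σ₀ there is one product fewer than there are monomials.
              separating-functional (as ++ bs) (ℕP.≤-reflexive (trans (sym (length-++-sucʳ as σ₀ bs))
                (trans (cong length (sym admissibles≡)) (length-map (decode ℓ) monomials))))
        in ym≢0 (Annihilators.annihilator-trivial d ℓ ℕP.≤-refl 1≤ℓ ℕP.≤-refl y-sym y-supp
             (kills t∈ c₀≢0 as bs admissibles≡ y kills-rest (y-relation cs relation)) m)

      vanish : ∀ {t} → t ∈ cs → proj₁ t ≡ 0ℚ
      vanish {c₀ , _} t∈ = decidable-stable (c₀ ℚP.≟ 0ℚ) (refute t∈)

  module _ (f : Poly) (inF : InF d ℓ f) (c : ℚ) (cs : List (ℚ × List (ℕ × ℕ)))
    (cs-admissibles : map proj₂ cs ≡ admissibles)
    (relation : ∀ {m} → m ∈ monomials → c * coeff f m + eval (λ σ → coeff (gProd σ) m) cs ≡ 0ℚ) where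

    private
      admissible-terms : All (λ t → Admissible d ℓ (proj₂ t)) cs
      admissible-terms = AllP.map⁻ (subst (All (Admissible d ℓ)) (sym cs-admissibles) (All.tabulate ∈-admissibles⁻))

    relation-trivial : c ≡ 0ℚ → All (λ t → proj₁ t ≡ 0ℚ) cs
    relation-trivial refl = independent cs admissible-terms
      (AllPairsP.map⁻ (subst Unique (sym cs-admissibles) admissibles-unique))
      (λ {m} m∈ → trans
        (sym (trans (cong (_+ eval (λ σ → coeff (gProd σ) m) cs) (ℚP.*-zeroˡ (coeff f m))) (ℚP.+-identityˡ _)))
        (relation m∈))

    relation-spans : c ≢ 0ℚ →
      Σ (List (ℚ × List (ℕ × ℕ))) (λ cs → All (λ t → Admissible d ℓ (proj₂ t)) cs × linComb cs ≈ f)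
    relation-spans c≢0 = map scale cs , AllP.map⁺ admissible-terms ,
      ≈-from-monomials (map scale cs) f (AllP.map⁺ admissible-terms) inF scaled
      where
        open ≡-Reasoning
        instance
          c-nonZero : ℚ.NonZero c
          c-nonZero = ℚ.≢-nonZero c≢0

        c⁻¹ : ℚ
        c⁻¹ = ℚ.1/ c

        scale : ℚ × List (ℕ × ℕ) → ℚ × List (ℕ × ℕ)
        scale (a , σ) = - (c⁻¹ * a) , σ

        isolate : ∀ x s → c * x + s ≡ 0ℚ → - c⁻¹ * s ≡ x
        isolate x s h = begin
          - c⁻¹ * s
            ≡⟨ solve 4 (λ i c x s → (:- i) :* s := (i :* c) :* x :- i :* (c :* x :+ s)) refl c⁻¹ c x s ⟩
          (c⁻¹ * c) * x - c⁻¹ * (c * x + s)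
            ≡⟨ cong₂ (λ a b → a * x - c⁻¹ * b) (ℚP.*-inverseˡ c) h ⟩
          1ℚ * x - c⁻¹ * 0ℚ
            ≡⟨ cong₂ _-_ (ℚP.*-identityˡ x) (ℚP.*-zeroʳ c⁻¹) ⟩
          x - 0ℚ
            ≡⟨ ℚP.+-identityʳ x ⟩
          x ∎

        scaled : ∀ {m} → m ∈ monomials → eval (λ σ → coeff (gProd σ) m) (map scale cs) ≡ coeff f m
        scaled {m} m∈ = begin
          eval (λ σ → coeff (gProd σ) m) (map scale cs)
            ≡⟨ ∑-map scale cs _ ⟩
          ∑[ t ∈ cs ] (- (c⁻¹ * proj₁ t) * coeff (gProd (proj₂ t)) m)
            ≡⟨ ∑-cong cs (λ t → solve 3 (λ i c x → :- (i :* c) :* x := (:- i) :* (c :* x)) refl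
                 c⁻¹ (proj₁ t) (coeff (gProd (proj₂ t)) m)) ⟩
          ∑[ t ∈ cs ] (- c⁻¹ * (proj₁ t * coeff (gProd (proj₂ t)) m))
            ≡⟨ ∑-*ˡ cs (- c⁻¹) _ ⟩
          - c⁻¹ * eval (λ σ → coeff (gProd σ) m) cs
            ≡⟨ isolate (coeff f m) _ (relation m∈) ⟩
          coeff f m ∎

  -- Together with f the products form one vector more than there are monomials, so their
  -- coefficient vectors are linearly dependent.
  dependence : ∀ f → ∃[ c ] ∃[ cs ] map proj₂ cs ≡ admissibles
    × (∀ {m} → m ∈ monomials → c * coeff f m + eval (λ σ → coeff (gProd σ) m) cs ≡ 0ℚ)
    × ¬ (c ≡ 0ℚ × All (λ t → proj₁ t ≡ 0ℚ) cs)
  dependence f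
    with underdetermined (f ∷ map gProd admissibles) (map (flip coeff) monomials)
           (ℕP.≤-reflexive (cong suc (trans (length-map (flip coeff) monomials)
             (sym (trans (length-map gProd admissibles) (length-map (decode ℓ) monomials))))))
  ... | [] , () , _
  ... | (c , p) ∷ ys , e , nontrivial , solves with ∷-injective e
  ...   | refl , ys-products with pairs-of-map gProd admissibles ys ys-products
  ...     | cs , cs-admissibles , refl = c , cs , cs-admissibles ,
    (λ {m} m∈ → trans (cong (c * coeff f m +_) (sym (∑-map _ cs _))) (All.lookup (AllP.map⁻ solves) m∈)) ,
    (λ (c≡0 , zeros) → AllP.All¬⇒¬Any
      (contradiction c≡0 ∷ AllP.map⁺ (All.map contradiction zeros)) nontrivial)

  -- In a non-trivial relation between f and the products the coefficient of f is non-zero, for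
  -- otherwise independence would make the relation trivial. Dividing by it expresses f.
  spanning : ∀ f → InF d ℓ f →
    Σ (List (ℚ × List (ℕ × ℕ))) (λ cs → All (λ t → Admissible d ℓ (proj₂ t)) cs × linComb cs ≈ f)
  spanning f inF =
    let c , cs , cs-admissibles , relation , nontrivial = dependence f
    in relation-spans f inF c cs cs-admissibles relation
         (λ c≡0 → nontrivial (c≡0 , relation-trivial f inF c cs cs-admissibles relation c≡0))

theorem3 : (d ℓ : ℕ) → 1 ≤ ℓ → ℓ ≤ d →
    ((f : Poly) → InF d ℓ f →
    Σ (List (ℚ × List (ℕ × ℕ))) (λ cs →
    All (λ t → Admissible d ℓ (proj₂ t)) cs × linComb cs ≈ f))
    ×
    ((cs : List (ℚ × List (ℕ × ℕ))) →
    All (λ t → Admissible d ℓ (proj₂ t)) cs →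
    AllPairs (λ s t → ¬ (gProd (proj₂ s) ≈ gProd (proj₂ t))) cs →
    linComb cs ≈ 0P →
    All (λ t → proj₁ t ≡ 0ℚ) cs)
theorem3 d ℓ 1≤ℓ _ = spanning , λ cs adm inequivalent relation →
  -- Equal sequences have equal products, so inequivalent products come from distinct sequences.
  independent cs adm (AllPairs.map (λ ¬≈ σ≡τ → ¬≈ (λ m → cong (λ σ → coeff (gProd σ) m) σ≡τ)) inequivalent)
    (λ {m} _ → trans (sym (coeff-linComb cs m)) (relation m))
  where open Basis d ℓ 1≤ℓ
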